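{- $\mathsf{UPSV_t} \subseteq \mathsf{TotP}$ if and only if $\mathsf{P} = \mathsf{UP} \cap \mathsf{coUP}$.
   Context: NPTM means nondeterministic polynomial-time bounded Turing machine. $\mathsf{TotP} = \{tot_M \mid M \text{ is an NPTM}\}$, where $tot_M(x) = Total_M(x) - 1$ and $Total_M(x)$ is the number of all computation paths of $M$ on input $x \in \Sigma^*$. $\mathsf{UPSV_t}$ is the class of total functions $f$ on $\Sigma^*$ for which there is an NPTM that on every input $x \in \Sigma^*$ has exactly one accepting path and outputs $f(x)$ on that path; here $\mathsf{UPSV_t}$ is assumed to contain only non-negative integer valued functions (values written in binary). $\mathsf{UP}$ is the class of languages $L$ for which there is an NPTM having exactly one accepting path on each $x \in L$ and no accepting path on each $x \notin L$; $\mathsf{coUP}$ is the class of complements of languages in $\mathsf{UP}$. -}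

module Defs where

open import Data.Bool using (Bool; true; false)
open import Data.Fin using (Fin)
open import Data.List using (List; []; _∷_; [_]; map; concatMap; foldl; foldr; length; filterᵇ)
open import Data.List.Relation.Unary.All using (All)
open import Data.List.Relation.Unary.Unique.Propositional using (Unique)
open import Data.Nat using (ℕ; zero; suc; _+_; _*_; _∸_; _≤_; _<_)
open import Data.Product using (_×_; _,_; ∃-syntax)
open import Data.Vec as Vec using (Vec)
open import Function.Bundles using (_↔_)
open import Level using (0ℓ) renaming (suc to lsuc)
open import Relation.Binary.PropositionalEquality using (_≡_; _≗_)
open import Relation.Unary using (Pred; _∈_; _∉_; ∁)

-- Σ = {0,1}, with false as 0 and true as 1.
Word : Set
Word = List Bool

Language : Set₁
Language = Pred Word 0ℓ

Finite : Set → Set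
Finite A = ∃[ n ] (A ↔ Fin n)

-- A polynomial with natural coefficients, constant term first.
Poly : Set
Poly = List ℕ

eval : Poly → ℕ → ℕ
eval p n = foldr (λ a r → a + n * r) 0 p

-- Tape alphabet {blank, 0, 1} ∪ X, with X the machine's auxiliary symbols.
data Symbol (X : Set) : Set where
  blank : Symbol X
  bit   : Bool → Symbol X
  aux   : X → Symbol X

data Move : Set where
  left stay right : Move

-- A two-way infinite tape.  Both lists start at the cell next to the head;
-- every cell not listed is blank.
record Tape (X : Set) : Set where
  constructor tape
  field
    before : List (Symbol X)
    head   : Symbol X
    after  : List (Symbol X)

open Tape public

blankTape : ∀ {X} → Tape X
blankTape = tape [] blank []

inputTape : ∀ {X} → Word → Tape X
inputTape []      = blankTape
inputTape (b ∷ w) = tape [] (bit b) (map bit w)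

move : ∀ {X} → Move → Tape X → Tape X
move stay  t                   = t
move left  (tape []       s r) = tape [] blank (s ∷ r)
move left  (tape (a ∷ l)  s r) = tape l a (s ∷ r)
move right (tape l s [])       = tape (s ∷ l) blank []
move right (tape l s (a ∷ r))  = tape (s ∷ l) a r

act : ∀ {X} → Symbol X × Move → Tape X → Tape X
act (s , m) t = move m (record t { head = s })

record Configuration (Q X : Set) (n : ℕ) : Set where
  constructor config
  field
    state : Q
    tapes : Vec (Tape X) n

open Configuration public

-- A nondeterministic Turing machine with suc k tapes.  The list δ q s enumerates,
-- without repetition, the transitions available in state q when s is read.
record TM : Set₁ where
  field
    k          : ℕ
    Aux        : Set
    State      : Set
    aux-finite : Finite Aux
    st-finite  : Finite State
    start      : State
    accepting  : State → Bool
    δ          : State → Vec (Symbol Aux) (suc k) →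
                 List (State × Vec (Symbol Aux × Move) (suc k))
    δ-unique   : ∀ q s → Unique (δ q s)

  Config : Set
  Config = Configuration State Aux (suc k)

  initial : Word → Config
  initial x = config start (inputTape x Vec.∷ Vec.replicate k blankTape)

  successors : Config → List Config
  successors (config q ts) =
    map (λ (q′ , as) → config q′ (Vec.zipWith act as ts)) (δ q (Vec.map head ts))

  Halted : Config → Set
  Halted c = successors c ≡ []

  -- The leaves, from left to right, of the computation tree with root c cut off at
  -- depth t.  If they are all halted nothing was cut off, and the list has one
  -- entry for each computation path, namely the configuration in which it ends
  -- (paths ending in equal configurations give separate entries).
  mutual
    leaves : ℕ → Config → List Config
    leaves zero    c = [ c ]
    leaves (suc t) c = leavesBelow t c (successors c)

    leavesBelow : ℕ → Config → List Config → List Config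
    leavesBelow t c []         = [ c ]
    leavesBelow t c (c′ ∷ cs)  = concatMap (leaves t) (c′ ∷ cs)

  Deterministic : Set
  Deterministic = ∀ q s → length (δ q s) ≤ 1

-- The bits on the first tape from the head rightwards, up to the first cell that
-- does not hold a bit.
leadingBits : ∀ {X} → List (Symbol X) → Word
leadingBits (bit b ∷ ss) = b ∷ leadingBits ss
leadingBits _            = []

digit : Bool → ℕ
digit false = 0
digit true  = 1

-- Most significant bit first; leading zeros are allowed.
binaryValue : Word → ℕ
binaryValue = foldl (λ n b → 2 * n + digit b) 0

record NPTM : Set₁ where
  field
    machine : TM
  open TM machine public
  field
    bound   : Poly
    halting : ∀ x → All Halted (leaves (eval bound (length x)) (initial x))

  paths : Word → List Config
  paths x = leaves (eval bound (length x)) (initial x)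

  acceptingPaths : Word → List Config
  acceptingPaths x = filterᵇ (λ c → accepting (state c)) (paths x)

  total : Word → ℕ
  total x = length (paths x)

  acc : Word → ℕ
  acc x = length (acceptingPaths x)

  tot : Word → ℕ
  tot x = total x ∸ 1

  output : Config → ℕ
  output c = binaryValue (leadingBits (head t ∷ after t))
    where t = Vec.head (tapes c)

open NPTM using (Deterministic; acceptingPaths; acc; tot; output)

TotP : Pred (Word → ℕ) (lsuc 0ℓ)
TotP f = ∃[ M ] (f ≗ tot M)

UPSVₜ : Pred (Word → ℕ) (lsuc 0ℓ)
UPSVₜ f = ∃[ M ] ∀ x → ∃[ c ] (acceptingPaths M x ≡ [ c ] × output M c ≡ f x)

P : Pred Language (lsuc 0ℓ)
P L = ∃[ M ] (Deterministic M ×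
              (∀ x → (x ∈ L → 0 < acc M x) × (x ∉ L → acc M x ≡ 0)))

UP : Pred Language (lsuc 0ℓ)
UP L = ∃[ M ] ∀ x → (x ∈ L → acc M x ≡ 1) × (x ∉ L → acc M x ≡ 0)

-- Membership is phrased through ∁ L, since constructively L need not be the
-- complement of any language.
coUP : Pred Language (lsuc 0ℓ)
coUP L = ∁ L ∈ UP

{-# OPTIONS --safe #-}
-- If UPSVₜ ⊆ TotP and L ∈ UP ∩ coUP through M₁ and M₂, then x ↦ acc M₁ x is in UPSVₜ (guess which
-- machine to run), hence equals tot M for some M.  So x ∈ L exactly if the computation of M on x
-- branches, and this can be decided by following M up to the first branching.
--
-- Conversely, for f in UPSVₜ the bits of f x, together with their number, are the answers to
-- membership queries of a language in UP ∩ coUP, decided by a deterministic D if P = UP ∩ coUP.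
-- A machine with f x + 1 paths asks for the bits from the most significant one on: each of the v live
-- paths belonging to a prefix of value v splits in two at every bit, and one spare path splits off a
-- live one at every bit 1.  The query words are extended by one symbol on the left from each query
-- to the next; in between, the run of D is undone step by step from a log, which restores
-- its tapes up to trailing blanks.
module Submission where

open import Defs
open import Data.Bool as Bool using (Bool; true; false; not; if_then_else_)
open import Data.Bool.Properties using (¬-not; T?)
open import Data.Empty using (⊥-elim)
open import Data.Fin using (Fin; zero; suc)
import Data.Fin as Fin
open import Data.Fin.Properties using (+↔⊎; *↔×; 1↔⊤; 2↔Bool; splitAt-↑ˡ; splitAt-↑ʳ)
open import Data.Integer using (ℤ; -[1+_]) renaming (+_ to pos)
open import Data.List as List using (List; []; _∷_; [_]; _++_; map; concatMap; filterᵇ; length)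
open import Data.List.Properties using (++-identityʳ; map-∘; length-++; length-map; concatMap-++)
open import Data.List.Relation.Binary.Pointwise as Pointwise using (Pointwise; []; _∷_)
open import Data.List.Relation.Unary.All using (All; []; _∷_)
import Data.List.Relation.Unary.All as All
import Data.List.Relation.Unary.All.Properties as All
open import Data.List.Relation.Unary.AllPairs using ([]; _∷_)
open import Data.List.Relation.Unary.Unique.Propositional using (Unique)
import Data.List.Relation.Unary.Unique.Propositional.Properties as Unique
open import Data.Maybe using (Maybe; just; nothing)
open import Data.Nat using (ℕ; zero; suc; _+_; _*_; _∸_; _≤_; _<_; z≤n; s≤s)
open import Data.Nat.Properties
open import Data.Nat.Tactic.RingSolver using (solve-∀)
open import Data.Product using (_×_; _,_; ∃-syntax; proj₁; proj₂)
open import Data.Product.Function.NonDependent.Propositional using (_×-↔_)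
open import Data.Sum using (_⊎_; inj₁; inj₂; [_,_]′)
open import Data.Sum.Function.Propositional using (_⊎-↔_)
open import Data.Unit using (⊤; tt)
open import Data.Vec as Vec using (Vec; []; _∷_)
open import Data.Vec.Properties
  using (lookup-map; lookup-zipWith; lookup-replicate; lookup∘tabulate; tabulate∘lookup; tabulate-cong)
import Data.Vec.Relation.Binary.Pointwise.Inductive as VecPointwise
open import Data.Vec.Relation.Binary.Pointwise.Inductive using ([]; _∷_)
open import Function using (id; _∘_)
open import Function.Bundles using (_⇔_; _↔_; mk↔ₛ′; mk⇔)
open import Function.Properties.Inverse using (↔-sym; ↔-trans)
open import Relation.Binary.PropositionalEquality hiding ([_])
open import Relation.Nullary using (¬_; _×-dec_; _⊎-dec_)
open import Relation.Nullary.Decidable using (decidable-stable)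
open import Relation.Unary using (_⊆_; _≐_; _∩_)

-- In the first direction a tree always has a path, so a `tot` with values 0 and 1 leaves one path
-- or two; a second path is certain as soon as one node branches, whatever lies below it. In the
-- converse TotP counts every leaf, accepting or not, so no path may be spent on a wrong guess. This
-- is where P enters: a deterministic query adds neither a branching nor a leaf. Some path always
-- exists even for the value 0, which is why a spare path accompanies the live ones; it is the path
-- that `tot` subtracts. Undoing D, rather than erasing its tapes, does not require knowing which
-- cells were used and also gives back the query word that D may have overwritten. The number of
-- bits has to be asked for because f x is stored nowhere. All measurements go through one relation
-- `Run t c vs`: the tree with root c has depth at most t, and vs concatenates the values of its
-- leaves. Constructively x ∈ L cannot be decided, so case distinctions are made on numbers and
-- Booleans.

-- Polynomials

-- Time bounds arise as arithmetic expressions, whereas an `NPTM` wants a coefficient list; the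
-- closure properties below produce the list from the expression.
IsPolynomial : (ℕ → ℕ) → Set
IsPolynomial g = ∃[ p ] (∀ n → eval p n ≡ g n)

addP : Poly → Poly → Poly
addP []      q       = q
addP (a ∷ p) []      = a ∷ p
addP (a ∷ p) (b ∷ q) = a + b ∷ addP p q

eval-addP : ∀ p q n → eval (addP p q) n ≡ eval p n + eval q n
eval-addP []      q       n = refl
eval-addP (a ∷ p) []      n = sym (+-identityʳ _)
eval-addP (a ∷ p) (b ∷ q) n rewrite eval-addP p q n = distribute a b n (eval p n) (eval q n)
  where
  distribute : ∀ a b n x y → a + b + n * (x + y) ≡ a + n * x + (b + n * y)
  distribute = solve-∀

mulP : Poly → Poly → Poly
mulP []      q = []
mulP (a ∷ p) q = addP (map (a *_) q) (0 ∷ mulP p q)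

eval-scale : ∀ a q n → eval (map (a *_) q) n ≡ a * eval q n
eval-scale a []      n = sym (*-zeroʳ a)
eval-scale a (b ∷ q) n rewrite eval-scale a q n = distribute a b n (eval q n)
  where
  distribute : ∀ a b n x → a * b + n * (a * x) ≡ a * (b + n * x)
  distribute = solve-∀

eval-mulP : ∀ p q n → eval (mulP p q) n ≡ eval p n * eval q n
eval-mulP []      q n = refl
eval-mulP (a ∷ p) q n
  rewrite eval-addP (map (a *_) q) (0 ∷ mulP p q) n | eval-scale a q n | eval-mulP p q n
  = distribute a n (eval p n) (eval q n)
  where
  distribute : ∀ a n x y → a * y + n * (x * y) ≡ (a + n * x) * y
  distribute = solve-∀

compP : Poly → Poly → Poly
compP []      q = []
compP (a ∷ p) q = addP (a ∷ []) (mulP q (compP p q))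

eval-compP : ∀ p q n → eval (compP p q) n ≡ eval p (eval q n)
eval-compP []      q n = refl
eval-compP (a ∷ p) q n
  rewrite eval-addP (a ∷ []) (mulP q (compP p q)) n | *-zeroʳ n | +-identityʳ a
        | eval-mulP q (compP p q) n | eval-compP p q n = refl

eval-isPolynomial : ∀ p → IsPolynomial (eval p)
eval-isPolynomial p = p , λ _ → refl

const-isPolynomial : ∀ a → IsPolynomial (λ _ → a)
const-isPolynomial a = a ∷ [] , λ n → trans (cong (a +_) (*-zeroʳ n)) (+-identityʳ a)

id-isPolynomial : IsPolynomial id
id-isPolynomial = 0 ∷ 1 ∷ [] , λ n → trans (cong (λ z → n * (1 + z)) (*-zeroʳ n)) (*-identityʳ n)

+-isPolynomial : ∀ {g h} → IsPolynomial g → IsPolynomial h → IsPolynomial (λ n → g n + h n)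
+-isPolynomial (p , p≡g) (q , q≡h) = addP p q , λ n → trans (eval-addP p q n) (cong₂ _+_ (p≡g n) (q≡h n))

*-isPolynomial : ∀ {g h} → IsPolynomial g → IsPolynomial h → IsPolynomial (λ n → g n * h n)
*-isPolynomial (p , p≡g) (q , q≡h) = mulP p q , λ n → trans (eval-mulP p q n) (cong₂ _*_ (p≡g n) (q≡h n))

∘-isPolynomial : ∀ p {g} → IsPolynomial g → IsPolynomial (λ n → eval p (g n))
∘-isPolynomial p (q , q≡g) = compP p q , λ n → trans (eval-compP p q n) (cong (eval p) (q≡g n))

eval-mono : ∀ p {m n} → m ≤ n → eval p m ≤ eval p n
eval-mono []      m≤n = z≤n
eval-mono (a ∷ p) m≤n = +-monoʳ-≤ a (*-mono-≤ m≤n (eval-mono p m≤n))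

-- Finite types

⊤-finite : Finite ⊤
⊤-finite = 1 , ↔-sym 1↔⊤

Bool-finite : Finite Bool
Bool-finite = 2 , ↔-sym 2↔Bool

⊎-finite : ∀ {A B} → Finite A → Finite B → Finite (A ⊎ B)
⊎-finite (m , f) (n , g) = m + n , ↔-trans (f ⊎-↔ g) (↔-sym +↔⊎)

×-finite : ∀ {A B} → Finite A → Finite B → Finite (A × B)
×-finite (m , f) (n , g) = m * n , ↔-trans (f ×-↔ g) (↔-sym *↔×)

finite-↔ : ∀ {A B} → A ↔ B → Finite B → Finite A
finite-↔ A↔B (n , g) = n , ↔-trans A↔B g

Vec-finite : ∀ {A} → Finite A → ∀ n → Finite (Vec A n)
Vec-finite fin zero    = finite-↔ (mk↔ₛ′ (λ _ → tt) (λ _ → []) (λ _ → refl) (λ { [] → refl })) ⊤-finite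
Vec-finite fin (suc n) =
  finite-↔ (mk↔ₛ′ (λ { (x ∷ xs) → x , xs }) (λ { (x , xs) → x ∷ xs }) (λ { (x , xs) → refl }) (λ { (x ∷ xs) → refl }))
    (×-finite fin (Vec-finite fin n))

Symbol-finite : ∀ {X} → Finite X → Finite (Symbol X)
Symbol-finite fin = finite-↔ (mk↔ₛ′ to from to∘from from∘to) (⊎-finite ⊤-finite (⊎-finite Bool-finite fin))
  where
  to : Symbol _ → ⊤ ⊎ (Bool ⊎ _)
  to blank   = inj₁ tt
  to (bit b) = inj₂ (inj₁ b)
  to (aux a) = inj₂ (inj₂ a)
  from : ⊤ ⊎ (Bool ⊎ _) → Symbol _
  from (inj₁ tt)       = blank
  from (inj₂ (inj₁ b)) = bit b
  from (inj₂ (inj₂ a)) = aux a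
  to∘from : ∀ y → to (from y) ≡ y
  to∘from (inj₁ tt)       = refl
  to∘from (inj₂ (inj₁ b)) = refl
  to∘from (inj₂ (inj₂ a)) = refl
  from∘to : ∀ x → from (to x) ≡ x
  from∘to blank   = refl
  from∘to (bit b) = refl
  from∘to (aux a) = refl

Move-finite : Finite Move
Move-finite = finite-↔ (mk↔ₛ′ to from to∘from from∘to) (⊎-finite ⊤-finite Bool-finite)
  where
  to : Move → ⊤ ⊎ Bool
  to left  = inj₂ false
  to stay  = inj₁ tt
  to right = inj₂ true
  from : ⊤ ⊎ Bool → Move
  from (inj₁ tt)    = stay
  from (inj₂ false) = left
  from (inj₂ true)  = right
  to∘from : ∀ y → to (from y) ≡ y
  to∘from (inj₁ tt)    = refl
  to∘from (inj₂ false) = refl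
  to∘from (inj₂ true)  = refl
  from∘to : ∀ x → from (to x) ≡ x
  from∘to left  = refl
  from∘to stay  = refl
  from∘to right = refl

-- Tapes up to trailing blanks

look : ∀ {X} → List (Symbol X) → ℕ → Symbol X
look []       n       = blank
look (s ∷ ss) zero    = s
look (s ∷ ss) (suc n) = look ss n

-- Addresses are relative to the head. Equality of `Tape`s is too fine, since moving past the end of
-- a list leaves a listed blank behind; the function of cells does not see it.
cell : ∀ {X} → Tape X → ℤ → Symbol X
cell t (pos zero)  = head t
cell t (pos (suc n)) = look (after t) n
cell t -[1+ n ]  = look (before t) n

write : ∀ {X} → Symbol X → Tape X → Tape X
write s t = record t { head = s }

shift : Move → ℤ → ℤ
shift left  (pos zero)     = -[1+ 0 ]
shift left  (pos (suc n))    = pos n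
shift left  -[1+ n ]     = -[1+ suc n ]
shift stay  z            = z
shift right (pos n)        = pos (suc n)
shift right -[1+ zero ]  = pos 0
shift right -[1+ suc n ] = -[1+ n ]

cell-move : ∀ {X} m (t : Tape X) z → cell (move m t) z ≡ cell t (shift m z)
cell-move left  (tape []      s r)       (pos zero)     = refl
cell-move left  (tape []      s r)       (pos (suc zero)) = refl
cell-move left  (tape []      s r)       (pos (suc (suc n))) = refl
cell-move left  (tape []      s r)       -[1+ n ]     = refl
cell-move left  (tape (a ∷ l) s r)       (pos zero)     = refl
cell-move left  (tape (a ∷ l) s r)       (pos (suc zero)) = refl
cell-move left  (tape (a ∷ l) s r)       (pos (suc (suc n))) = refl
cell-move left  (tape (a ∷ l) s r)       -[1+ n ]     = refl
cell-move stay  t                        z            = refl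
cell-move right (tape l s [])            (pos zero)     = refl
cell-move right (tape l s [])            (pos (suc n))    = refl
cell-move right (tape l s [])            -[1+ zero ]  = refl
cell-move right (tape l s [])            -[1+ suc n ] = refl
cell-move right (tape l s (a ∷ r))       (pos zero)     = refl
cell-move right (tape l s (a ∷ r))       (pos (suc n))    = refl
cell-move right (tape l s (a ∷ r))       -[1+ zero ]  = refl
cell-move right (tape l s (a ∷ r))       -[1+ suc n ] = refl

opposite : Move → Move
opposite left  = right
opposite stay  = stay
opposite right = left

shift-opposite : ∀ m z → shift m (shift (opposite m) z) ≡ z
shift-opposite left  (pos n)         = refl
shift-opposite left  -[1+ zero ]   = refl
shift-opposite left  -[1+ suc n ]  = refl
shift-opposite stay  z             = refl
shift-opposite right (pos zero)      = refl
shift-opposite right (pos (suc n))     = refl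
shift-opposite right -[1+ n ]      = refl

-- Comparing cells modulo `dec` absorbs two differences at once: the larger alphabet of a host and
-- the listed trailing blanks.
record Decodes {Y X : Set} (dec : Symbol Y → Symbol X) (t : Tape Y) (u : Tape X) : Set where
  constructor decodes
  field
    decode : ∀ z → dec (cell t z) ≡ cell u z

open Decodes

decodes-head : ∀ {Y X} {dec : Symbol Y → Symbol X} {t u} → Decodes dec t u → dec (head t) ≡ head u
decodes-head t~u = decode t~u (pos zero)

decodes-write : ∀ {Y X} {dec : Symbol Y → Symbol X} {t u s s′} →
                Decodes dec t u → dec s ≡ s′ → Decodes dec (write s t) (write s′ u)
decodes-write t~u s~s′ .decode (pos zero)    = s~s′
decodes-write t~u s~s′ .decode (pos (suc n)) = decode t~u (pos (suc n))
decodes-write t~u s~s′ .decode -[1+ n ]      = decode t~u -[1+ n ]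

decodes-move : ∀ {Y X} {dec : Symbol Y → Symbol X} m {t u} →
               Decodes dec t u → Decodes dec (move m t) (move m u)
decodes-move {dec = dec} m {t} {u} t~u .decode z =
  trans (cong dec (cell-move m t z)) (trans (decode t~u (shift m z)) (sym (cell-move m u z)))

decodes-act : ∀ {Y X} {dec : Symbol Y → Symbol X} m {t u s s′} →
              Decodes dec t u → dec s ≡ s′ → Decodes dec (act (s , m) t) (act (s′ , m) u)
decodes-act m t~u s~s′ = decodes-move m (decodes-write t~u s~s′)

decodes-unwrite : ∀ {Y X} {dec : Symbol Y → Symbol X} {t u s s′} →
                  Decodes dec t (write s′ u) → dec s ≡ head u → Decodes dec (write s t) u
decodes-unwrite t~u s~u .decode (pos zero)    = s~u
decodes-unwrite t~u s~u .decode (pos (suc n)) = decode t~u (pos (suc n))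
decodes-unwrite t~u s~u .decode -[1+ n ]      = decode t~u -[1+ n ]

-- Opposite moves cancel only cell by cell: going left and then right from `tape [] s r` gives
-- `tape [ blank ] s r`.
decodes-unmove : ∀ {Y X} {dec : Symbol Y → Symbol X} m {t u} →
                 Decodes dec t (move m u) → Decodes dec (move (opposite m) t) u
decodes-unmove {dec = dec} m {t} {u} t~u .decode z = begin
  dec (cell (move (opposite m) t) z)       ≡⟨ cong dec (cell-move (opposite m) t z) ⟩
  dec (cell t (shift (opposite m) z))      ≡⟨ decode t~u (shift (opposite m) z) ⟩
  cell (move m u) (shift (opposite m) z)   ≡⟨ cell-move m u (shift (opposite m) z) ⟩
  cell u (shift m (shift (opposite m) z))  ≡⟨ cong (cell u) (shift-opposite m z) ⟩
  cell u z                                 ∎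
  where open ≡-Reasoning

cell-inputTape⁺ : ∀ {X} w n → cell {X} (inputTape w) (pos n) ≡ look (map bit w) n
cell-inputTape⁺ []      zero    = refl
cell-inputTape⁺ []      (suc n) = refl
cell-inputTape⁺ (b ∷ w) zero    = refl
cell-inputTape⁺ (b ∷ w) (suc n) = refl

cell-inputTape⁻ : ∀ {X} w n → cell {X} (inputTape w) -[1+ n ] ≡ blank
cell-inputTape⁻ []      n = refl
cell-inputTape⁻ (b ∷ w) n = refl

[]≢∷ : ∀ {A : Set} {x : A} {xs : List A} → ¬ (List.[] ≡ x ∷ xs)
[]≢∷ ()

results : ∀ {Q X n} → Vec (Tape X) n → List (Q × Vec (Symbol X × Move) n) → List (Configuration Q X n)
results ts = map (λ (q , as) → config q (Vec.zipWith act as ts))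

successors-≡ : ∀ M {q ts l} → TM.δ M q (Vec.map head ts) ≡ l → TM.successors M (config q ts) ≡ results ts l
successors-≡ M {ts = ts} = cong (results ts)

-- Values of computation trees

-- Leaf values are lists so that one relation covers every count: `[ tt ]` at each leaf counts
-- paths, `[ tt ]` at accepting leaves counts acceptance, and the output at accepting leaves
-- collects the results.
module Evaluation (M : TM) {V : Set} (value : TM.Config M → List V) where
  open TM M

  mutual
    data Run : ℕ → Config → List V → Set where
      halt : ∀ {t c} → Halted c → Run t c (value c)
      step : ∀ {t c c′ cs vs} → successors c ≡ c′ ∷ cs → Runs t (c′ ∷ cs) vs → Run (suc t) c vs

    data Runs (t : ℕ) : List Config → List V → Set where
      []  : Runs t [] []
      _∷_ : ∀ {c cs us vs} → Run t c us → Runs t cs vs → Runs t (c ∷ cs) (us ++ vs)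

  mutual
    run-mono : ∀ {t t′ c vs} → t ≤ t′ → Run t c vs → Run t′ c vs
    run-mono t≤t′       (halt h)    = halt h
    run-mono (s≤s t≤t′) (step e rs) = step e (runs-mono t≤t′ rs)

    runs-mono : ∀ {t t′ cs vs} → t ≤ t′ → Runs t cs vs → Runs t′ cs vs
    runs-mono t≤t′ []       = []
    runs-mono t≤t′ (r ∷ rs) = run-mono t≤t′ r ∷ runs-mono t≤t′ rs

  step₁ : ∀ {t c c′ vs} → successors c ≡ [ c′ ] → Run t c′ vs → Run (suc t) c vs
  step₁ {vs = vs} e r = step e (subst (Runs _ _) (++-identityʳ vs) (r ∷ []))

  step₂ : ∀ {t c c′ c″ us vs} → successors c ≡ c′ ∷ c″ ∷ [] →
          Run t c′ us → Run t c″ vs → Run (suc t) c (us ++ vs)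
  step₂ {us = us} {vs} e r r′ =
    step e (subst (Runs _ _) (cong (us ++_) (++-identityʳ vs)) (r ∷ r′ ∷ []))

  leaves-halted : ∀ t {c} → Halted c → leaves t c ≡ [ c ]
  leaves-halted zero    h = refl
  leaves-halted (suc t) h rewrite h = refl

  mutual
    run-leaves : ∀ {t c vs} → Run t c vs → All Halted (leaves t c) × concatMap value (leaves t c) ≡ vs
    run-leaves {t} {c} (halt h) rewrite leaves-halted t h = h ∷ [] , ++-identityʳ (value c)
    run-leaves (step e rs) rewrite e = runs-leaves rs

    runs-leaves : ∀ {t cs vs} → Runs t cs vs →
                  All Halted (concatMap (leaves t) cs) × concatMap value (concatMap (leaves t) cs) ≡ vs
    runs-leaves [] = [] , refl
    runs-leaves {t} (_∷_ {c} {cs} r rs) =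
      All.++⁺ (proj₁ (run-leaves r)) (proj₁ (runs-leaves rs)) ,
      trans (concatMap-++ value (leaves t c) (concatMap (leaves t) cs))
            (cong₂ _++_ (proj₂ (run-leaves r)) (proj₂ (runs-leaves rs)))

  mutual
    leaves-run : ∀ t c → All Halted (leaves t c) → Run t c (concatMap value (leaves t c))
    leaves-run zero    c (h ∷ []) = subst (Run zero c) (sym (++-identityʳ (value c))) (halt h)
    leaves-run (suc t) c hs with successors c in e
    ... | []      = subst (Run (suc t) c) (sym (++-identityʳ (value c))) (halt e)
    ... | c′ ∷ cs = step e (leaves-runs t (c′ ∷ cs) hs)

    leaves-runs : ∀ t cs → All Halted (concatMap (leaves t) cs) →
                  Runs t cs (concatMap value (concatMap (leaves t) cs))
    leaves-runs t []       hs = []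
    leaves-runs t (c ∷ cs) hs =
      subst (Runs t (c ∷ cs)) (sym (concatMap-++ value (leaves t c) (concatMap (leaves t) cs)))
        (leaves-run t c (All.++⁻ˡ (leaves t c) hs) ∷ leaves-runs t cs (All.++⁻ʳ (leaves t c) hs))

open Evaluation

-- N follows M step by step under the relation _~_ and may continue for up to t′ steps once M has halted.
module Simulation (M N : TM) {V : Set} (value : TM.Config M → List V) (value′ : TM.Config N → List V)
  (_~_ : TM.Config M → TM.Config N → Set) (t′ : ℕ)
  (~-halted : ∀ {c d} → c ~ d → TM.Halted M c → Run N value′ t′ d (value c))
  (~-step : ∀ {c d} → c ~ d → ¬ TM.Halted M c → Pointwise _~_ (TM.successors M c) (TM.successors N d))
  where

  mutual
    simulate : ∀ {t c d vs} → c ~ d → Run M value t c vs → Run N value′ (t + t′) d vs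
    simulate {t} c~d (halt h) = run-mono N value′ (m≤n+m t′ t) (~-halted c~d h)
    simulate {d = d} c~d (step e rs)
      with TM.successors N d in e′
         | subst (λ cs → Pointwise _~_ cs (TM.successors N d)) e (~-step c~d λ h → []≢∷ (trans (sym h) e))
    ... | d′ ∷ ds | ps = step e′ (simulates ps rs)

    simulates : ∀ {t cs ds vs} → Pointwise _~_ cs ds → Runs M value t cs vs → Runs N value′ (t + t′) ds vs
    simulates []       []       = []
    simulates (p ∷ ps) (r ∷ rs) = simulate p r ∷ simulates ps rs

-- Path counts of polynomial-time machines

concatMap-filter : ∀ {A B : Set} (p : A → Bool) (h : A → List B) xs →
                   concatMap (λ x → if p x then h x else []) xs ≡ concatMap h (filterᵇ p xs)
concatMap-filter p h []       = refl
concatMap-filter p h (x ∷ xs) with p x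
... | true  = cong (h x ++_) (concatMap-filter p h xs)
... | false = concatMap-filter p h xs

concatMap-if : ∀ {A B : Set} (p : A → Bool) (h : A → B) xs →
               concatMap (λ x → if p x then [ h x ] else []) xs ≡ map h (filterᵇ p xs)
concatMap-if p h []       = refl
concatMap-if p h (x ∷ xs) with p x
... | true  = cong (h x ∷_) (concatMap-if p h xs)
... | false = concatMap-if p h xs

verdict : ∀ (M : TM) → TM.Config M → List ⊤
verdict M c = if TM.accepting M (state c) then [ tt ] else []

length-verdicts : ∀ M x → length (concatMap (verdict (NPTM.machine M)) (NPTM.paths M x)) ≡ NPTM.acc M x
length-verdicts M x =
  trans (cong length (concatMap-if (λ c → accepting (state c)) (λ _ → tt) (paths x)))
        (length-map (λ _ → tt) (acceptingPaths x))
  where open NPTM M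

paths-run : ∀ (M : NPTM) {V : Set} (value : NPTM.Config M → List V) x →
            Run (NPTM.machine M) value (eval (NPTM.bound M) (length x)) (NPTM.initial M x)
              (concatMap value (NPTM.paths M x))
paths-run M value x = leaves-run (NPTM.machine M) value _ _ (NPTM.halting M x)

-- A run within time g does double duty: it provides the `halting` field and computes the values on
-- the paths of the resulting `NPTM`.
module Clocked (M : TM) {V : Set} (value : TM.Config M → List V) {g : ℕ → ℕ} (g-poly : IsPolynomial g)
  {vs : Word → List V} (run : ∀ x → Run M value (g (length x)) (TM.initial M x) (vs x)) where

  private
    result : ∀ x → All (TM.Halted M) (TM.leaves M (eval (proj₁ g-poly) (length x)) (TM.initial M x)) ×
             concatMap value (TM.leaves M (eval (proj₁ g-poly) (length x)) (TM.initial M x)) ≡ vs x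
    result x = run-leaves M value
      (subst (λ t → Run M value t _ _) (sym (proj₂ g-poly (length x))) (run x))

  clocked : NPTM
  clocked = record { machine = M ; bound = proj₁ g-poly ; halting = λ x → proj₁ (result x) }

  clocked-values : ∀ x → concatMap value (NPTM.paths clocked x) ≡ vs x
  clocked-values x = proj₂ (result x)

open Clocked

acc-clocked : ∀ M {g} (g-poly : IsPolynomial g) {vs : Word → List ⊤}
              (run : ∀ x → Run M (verdict M) (g (length x)) (TM.initial M x) (vs x)) x →
              NPTM.acc (clocked M (verdict M) g-poly run) x ≡ length (vs x)
acc-clocked M g-poly {vs} run x =
  trans (sym (length-verdicts (clocked M (verdict M) g-poly {vs} run) x))
        (cong length (clocked-values M (verdict M) g-poly {vs} run x))

-- Deterministic machines

deterministic-leaves : ∀ M → TM.Deterministic M → ∀ t c → ∃[ c′ ] TM.leaves M t c ≡ [ c′ ]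
deterministic-leaves M det zero    c = c , refl
deterministic-leaves M det (suc t) c@(config q ts) with TM.δ M q (Vec.map head ts) | det q (Vec.map head ts)
... | []          | _ = c , refl
... | (q′ , as) ∷ [] | _ with deterministic-leaves M det t (config q′ (Vec.zipWith act as ts))
...   | c′ , e = c′ , trans (++-identityʳ _) e
deterministic-leaves M det (suc t) (config q ts) | _ ∷ _ ∷ _ | s≤s ()

deterministic-path : ∀ M → NPTM.Deterministic M → ∀ x → ∃[ c ] NPTM.paths M x ≡ [ c ]
deterministic-path M det x = 
  deterministic-leaves (NPTM.machine M) det (eval (NPTM.bound M) (length x)) (NPTM.initial M x)

-- A deterministic machine has a single path, so exchanging acceptance and rejection complements its
-- language.
flip : TM → TM
flip M = record { TM M ; accepting = not ∘ TM.accepting M }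

flip-halted : ∀ M {c d} → c ≡ d → TM.Halted M c → Run (flip M) (verdict (flip M)) 0 d (verdict (flip M) c)
flip-halted M refl h = halt h

flip-step : ∀ M {c d} → c ≡ d → ¬ TM.Halted M c → Pointwise _≡_ (TM.successors M c) (TM.successors (flip M) d)
flip-step M refl _ = Pointwise.refl refl

module Flipping (M : TM) = Simulation M (flip M) (verdict (flip M)) (verdict (flip M)) _≡_ 0
  (flip-halted M) (flip-step M)

flip-run : ∀ (M : NPTM) x →
  Run (flip (NPTM.machine M)) (verdict (flip (NPTM.machine M))) (eval (NPTM.bound M) (length x) + 0)
    (NPTM.initial M x) (concatMap (verdict (flip (NPTM.machine M))) (NPTM.paths M x))
flip-run M x = Flipping.simulate (NPTM.machine M) refl (paths-run M (verdict (flip (NPTM.machine M))) x)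

P⊆UP∩coUP : P ⊆ (UP ∩ coUP)
P⊆UP∩coUP {L} (M , det , spec) = (M , λ x → inUP x) , (M̄ , λ x → inCoUP x)
  where
  open NPTM M using (machine; bound)

  poly : IsPolynomial (λ n → eval bound n + 0)
  poly = +-isPolynomial (eval-isPolynomial bound) (const-isPolynomial 0)

  M̄ : NPTM
  M̄ = clocked (flip machine) (verdict (flip machine)) poly (flip-run M)

  accM̄ : ∀ x → NPTM.acc M̄ x ≡ length (concatMap (verdict (flip machine)) (NPTM.paths M x))
  accM̄ = acc-clocked (flip machine) poly (flip-run M)

  inUP : ∀ x → (L x → NPTM.acc M x ≡ 1) × (¬ L x → NPTM.acc M x ≡ 0)
  inUP x with deterministic-path M det x | spec x
  ... | c , e | x∈ , x∉ rewrite e with NPTM.accepting M (state c)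
  ...   | true  = (λ _ → refl) , x∉
  ...   | false = (λ x∈L → ⊥-elim (n≮n 0 (x∈ x∈L))) , x∉

  inCoUP : ∀ x → (¬ L x → NPTM.acc M̄ x ≡ 1) × (¬ ¬ L x → NPTM.acc M̄ x ≡ 0)
  inCoUP x rewrite accM̄ x with deterministic-path M det x | spec x
  ... | c , e | x∈ , x∉ rewrite e with NPTM.accepting M (state c)
  ...   | true  = (λ x∉L → sym (x∉ x∉L)) , λ _ → refl
  ...   | false = (λ _ → refl) , λ ¬x∉L → ⊥-elim (¬x∉L λ x∈L → n≮n 0 (x∈ x∈L))

-- Deciding deterministically whether a computation branches

module Branching (M : TM) where
  open TM M using (k; Aux; State)

  detect : Vec (Symbol Aux) (suc k) → List (State × Vec (Symbol Aux × Move) (suc k)) →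
           List ((⊤ ⊎ State) × Vec (Symbol Aux × Move) (suc k))
  detect s []                = []
  detect s ((q , as) ∷ [])   = [ (inj₂ q , as) ]
  detect s (_ ∷ _ ∷ _)       = [ (inj₁ tt , Vec.map (_, stay) s) ]

  detect-short : ∀ s l → length (detect s l) ≤ 1
  detect-short s []          = z≤n
  detect-short s (_ ∷ [])    = s≤s z≤n
  detect-short s (_ ∷ _ ∷ _) = s≤s z≤n

  δ′ : ⊤ ⊎ State → Vec (Symbol Aux) (suc k) → List ((⊤ ⊎ State) × Vec (Symbol Aux × Move) (suc k))
  δ′ (inj₁ tt) s = []
  δ′ (inj₂ q)  s = detect s (TM.δ M q s)

  δ′-short : ∀ q s → length (δ′ q s) ≤ 1
  δ′-short (inj₁ tt) s = z≤n
  δ′-short (inj₂ q)  s = detect-short s (TM.δ M q s)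

  unique-short : ∀ {A : Set} {xs : List A} → length xs ≤ 1 → Unique xs
  unique-short {xs = []}     _ = []
  unique-short {xs = x ∷ []} _ = [] ∷ []
  unique-short {xs = x ∷ y ∷ xs} (s≤s ())

  machine : TM
  machine = record
    { k          = k
    ; Aux        = Aux
    ; State      = ⊤ ⊎ State
    ; aux-finite = TM.aux-finite M
    ; st-finite  = ⊎-finite ⊤-finite (TM.st-finite M)
    ; start      = inj₂ (TM.start M)
    ; accepting  = λ { (inj₁ tt) → true ; (inj₂ _) → false }
    ; δ          = δ′
    ; δ-unique   = λ q s → unique-short (δ′-short q s)
    }

  several : List ⊤ → List ⊤
  several []          = []
  several (_ ∷ [])    = []
  several (_ ∷ _ ∷ _) = [ tt ]

  mutual
    run-nonempty : ∀ {t c vs} → Run M (λ _ → [ tt ]) t c vs → 1 ≤ length vs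
    run-nonempty (halt h)    = s≤s z≤n
    run-nonempty (step e rs) = runs-nonempty rs

    runs-nonempty : ∀ {t c cs vs} → Runs M (λ _ → [ tt ]) t (c ∷ cs) vs → 1 ≤ length vs
    runs-nonempty (_∷_ {us = us} r rs) =
      ≤-trans (run-nonempty r) (≤-trans (m≤m+n _ _) (≤-reflexive (sym (length-++ us))))

  several-++ : ∀ us vs → 1 ≤ length us → 1 ≤ length vs → several (us ++ vs) ≡ [ tt ]
  several-++ (_ ∷ [])    (_ ∷ _) _ _ = refl
  several-++ (_ ∷ _ ∷ _) _       _ _ = refl

  -- Up to the first branching the tree is a chain, which is followed step by step. At the branching
  -- at least two subtrees hang below, each with a leaf, so the answer is settled and the machine
  -- stops.
  branching-run : ∀ {t q ts vs} → Run M (λ _ → [ tt ]) t (config q ts) vs →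
                  Run machine (verdict machine) t (config (inj₂ q) ts) (several vs)
  branching-run {q = q} {ts} (halt h) with TM.δ M q (Vec.map head ts) in e
  ... | [] = halt (successors-≡ machine {inj₂ q} (cong (detect (Vec.map head ts)) e))
  branching-run {q = q} {ts} (step e rs) with TM.δ M q (Vec.map head ts) in e′
  branching-run {q = q} {ts} (step refl (r ∷ [])) | _ ∷ [] =
    step₁ machine (verdict machine) (successors-≡ machine {inj₂ q} (cong (detect (Vec.map head ts)) e′))
      (subst (Run machine (verdict machine) _ _) (cong several (sym (++-identityʳ _))) (branching-run r))
  branching-run {q = q} {ts} (step refl (_∷_ {us = us} r rs)) | _ ∷ _ ∷ _ =
    step₁ machine (verdict machine) (successors-≡ machine {inj₂ q} (cong (detect (Vec.map head ts)) e′))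
      (subst (Run machine (verdict machine) _ _)
        (sym (several-++ us _ (run-nonempty r) (runs-nonempty rs))) (halt refl))

map-≡[] : ∀ {A B : Set} {f : A → B} {xs} → map f xs ≡ [] → xs ≡ []
map-≡[] {xs = []} _ = refl

pointwise-map : ∀ {A B C : Set} {R : B → C → Set} {f : A → B} {g : A → C} →
                (∀ x → R (f x) (g x)) → ∀ xs → Pointwise R (map f xs) (map g xs)
pointwise-map r []       = []
pointwise-map r (x ∷ xs) = r x ∷ pointwise-map r xs

-- Running a machine inside another one

act-idle : ∀ {X n} (ts : Vec (Tape X) n) → Vec.zipWith act (Vec.map (_, stay) (Vec.map head ts)) ts ≡ ts
act-idle []       = refl
act-idle (t ∷ ts) = cong (t ∷_) (act-idle ts)

-- `dec-emb` makes the guest read back what it wrote; `dec-blank` and `dec-bit` let an input tape of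
-- the host serve as an input tape of the guest.
record Decoder (Y X : Set) : Set where
  field
    dec       : Symbol Y → Symbol X
    emb       : Symbol X → Symbol Y
    dec-emb   : ∀ s → dec (emb s) ≡ s
    dec-blank : dec blank ≡ blank
    dec-bit   : ∀ b → dec (bit b) ≡ bit b

  emb-injective : ∀ {s s′} → emb s ≡ emb s′ → s ≡ s′
  emb-injective {s} {s′} e = trans (sym (dec-emb s)) (trans (cong dec e) (dec-emb s′))

  decodes-inputTape : ∀ w → Decodes dec (inputTape w) (inputTape w)
  decodes-inputTape w .decode (pos n) =
    trans (cong dec (cell-inputTape⁺ w n)) (trans (look-bits w n) (sym (cell-inputTape⁺ w n)))
    where
    look-bits : ∀ w n → dec (look (map bit w) n) ≡ look (map bit w) n
    look-bits []      n       = dec-blank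
    look-bits (b ∷ w) zero    = dec-bit b
    look-bits (b ∷ w) (suc n) = look-bits w n
  decodes-inputTape w .decode -[1+ n ] =
    trans (cong dec (cell-inputTape⁻ w n)) (trans dec-blank (sym (cell-inputTape⁻ w n)))

  -- This covers the empty word too, where the tapes differ as lists: the blank under the head gets
  -- listed after the new bit.
  decodes-prepend : ∀ {t w} b → Decodes dec t (inputTape w) →
                    Decodes dec (write (bit b) (move left t)) (inputTape (b ∷ w))
  decodes-prepend b t~w .decode (pos zero) = dec-bit b
  decodes-prepend {t} {w} b t~w .decode (pos (suc n)) =
    trans (cong dec (cell-move left t (pos (suc n)))) (trans (decode t~w (pos n)) (cell-inputTape⁺ w n))
  decodes-prepend {t} {w} b t~w .decode -[1+ n ] =
    trans (cong dec (cell-move left t -[1+ n ])) (trans (decode t~w -[1+ suc n ]) (cell-inputTape⁻ w (suc n)))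

  decodes-unprepend : ∀ {t w b} → Decodes dec t (inputTape (b ∷ w)) →
                      Decodes dec (move right (write blank t)) (inputTape w)
  decodes-unprepend {t} {w} t~bw .decode (pos n) =
    trans (cong dec (cell-move right (write blank t) (pos n)))
      (trans (decode t~bw (pos (suc n))) (sym (cell-inputTape⁺ w n)))
  decodes-unprepend {t} {w} t~bw .decode -[1+ zero ] =
    trans (cong dec (cell-move right (write blank t) -[1+ zero ])) (trans dec-blank (sym (cell-inputTape⁻ w 0)))
  decodes-unprepend {t} {w} t~bw .decode -[1+ suc n ] =
    trans (cong dec (cell-move right (write blank t) -[1+ suc n ]))
      (trans (decode t~bw -[1+ n ]) (sym (cell-inputTape⁻ w (suc n))))

open Decoder

-- The symbols contributed by the other summand are read as blanks.
injection₁ : ∀ {A B} → Decoder (A ⊎ B) A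
injection₁ .dec blank          = blank
injection₁ .dec (bit b)        = bit b
injection₁ .dec (aux (inj₁ a)) = aux a
injection₁ .dec (aux (inj₂ b)) = blank
injection₁ .emb blank          = blank
injection₁ .emb (bit b)        = bit b
injection₁ .emb (aux a)        = aux (inj₁ a)
injection₁ .dec-emb blank      = refl
injection₁ .dec-emb (bit b)    = refl
injection₁ .dec-emb (aux a)    = refl
injection₁ .dec-blank          = refl
injection₁ .dec-bit b          = refl

injection₂ : ∀ {A B} → Decoder (A ⊎ B) B
injection₂ .dec blank          = blank
injection₂ .dec (bit b)        = bit b
injection₂ .dec (aux (inj₁ a)) = blank
injection₂ .dec (aux (inj₂ b)) = aux b
injection₂ .emb blank          = blank
injection₂ .emb (bit b)        = bit b
injection₂ .emb (aux b)        = aux (inj₂ b)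
injection₂ .dec-emb blank      = refl
injection₂ .dec-emb (bit b)    = refl
injection₂ .dec-emb (aux b)    = refl
injection₂ .dec-blank          = refl
injection₂ .dec-bit b          = refl

identical : ∀ {A} → Decoder A A
identical .dec s       = s
identical .emb s       = s
identical .dec-emb s   = refl
identical .dec-blank   = refl
identical .dec-bit b   = refl

-- Guest tape i is host tape ι i; the host tapes without a guest (ρ j ≡ nothing) stay idle.
module Host (M : TM) {Y : Set} {n : ℕ} (D : Decoder Y (TM.Aux M))
  (ι : Fin (suc (TM.k M)) → Fin n) (ρ : Fin n → Maybe (Fin (suc (TM.k M)))) (ρ-ι : ∀ i → ρ (ι i) ≡ just i)
  {Q : Set} (run : TM.State M → Q) (exit : TM.State M → Vec (Symbol Y) n → List (Q × Vec (Symbol Y × Move) n))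
  where

  open TM M using (k; Aux; State; δ)

  view : Vec (Symbol Y) n → Vec (Symbol Aux) (suc k)
  view s = Vec.tabulate (λ i → dec D (Vec.lookup s (ι i)))

  hostAct : Symbol Y → Maybe (Fin (suc k)) → Vec (Symbol Aux × Move) (suc k) → Symbol Y × Move
  hostAct s nothing  as = s , stay
  hostAct s (just i) as = emb D (proj₁ (Vec.lookup as i)) , proj₂ (Vec.lookup as i)

  host : Vec (Symbol Y) n → Vec (Symbol Aux × Move) (suc k) → Vec (Symbol Y × Move) n
  host s as = Vec.tabulate (λ j → hostAct (Vec.lookup s j) (ρ j) as)

  lift : Vec (Symbol Y) n → State × Vec (Symbol Aux × Move) (suc k) → Q × Vec (Symbol Y × Move) n
  lift s (q , as) = run q , host s as

  orElse : List (Q × Vec (Symbol Y × Move) n) → List (Q × Vec (Symbol Y × Move) n) →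
           List (Q × Vec (Symbol Y × Move) n)
  orElse []      l′ = l′
  orElse (x ∷ l) l′ = x ∷ l

  -- The guest halts exactly where its `δ` is empty; these entries of the table are free for `exit`,
  -- so no step is spent on noticing the halt.
  δ-host : State → Vec (Symbol Y) n → List (Q × Vec (Symbol Y × Move) n)
  δ-host q s = orElse (map (lift s) (δ q (view s))) (exit q s)

  lookup-host : ∀ s as i → Vec.lookup (host s as) (ι i) ≡
                (emb D (proj₁ (Vec.lookup as i)) , proj₂ (Vec.lookup as i))
  lookup-host s as i =
    trans (lookup∘tabulate _ (ι i)) (cong (λ r → hostAct (Vec.lookup s (ι i)) r as) (ρ-ι i))

  -- Since `ρ` inverts `ι`, every guest action can be read off from the host's action on tape `ι i`.
  -- This keeps the host's transition lists free of repetition.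
  host-injective : ∀ s {as as′} → host s as ≡ host s as′ → as ≡ as′
  host-injective s {as} {as′} e =
    trans (sym (tabulate∘lookup as)) (trans (tabulate-cong same) (tabulate∘lookup as′))
    where
    same : ∀ i → Vec.lookup as i ≡ Vec.lookup as′ i
    same i = cong₂ _,_ (emb-injective D (cong proj₁ acts)) (cong proj₂ acts)
      where acts = trans (sym (lookup-host s as i)) (trans (cong (λ v → Vec.lookup v (ι i)) e) (lookup-host s as′ i))

  orElse-unique : ∀ {l l′} → Unique l → Unique l′ → Unique (orElse l l′)
  orElse-unique {[]}    u u′ = u′
  orElse-unique {x ∷ l} u u′ = u

  δ-host-unique : (∀ {q q′} → run q ≡ run q′ → q ≡ q′) → ∀ q s → Unique (exit q s) → Unique (δ-host q s)
  δ-host-unique run-injective q s = orElse-unique (Unique.map⁺ lift-injective (TM.δ-unique M q (view s)))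
    where
    lift-injective : ∀ {x y} → lift s x ≡ lift s y → x ≡ y
    lift-injective e = cong₂ _,_ (run-injective (cong proj₁ e)) (host-injective s (cong proj₂ e))

  record Carries (ts : Vec (Tape Y) n) (us : Vec (Tape Aux) (suc k)) : Set where
    constructor carries
    field
      carried : ∀ i → Decodes (dec D) (Vec.lookup ts (ι i)) (Vec.lookup us i)

  open Carries

  view-heads : ∀ {ts us} → Carries ts us → view (Vec.map head ts) ≡ Vec.map head us
  view-heads {ts} {us} c = trans (tabulate-cong same) (tabulate∘lookup _)
    where
    same : ∀ i → dec D (Vec.lookup (Vec.map head ts) (ι i)) ≡ Vec.lookup (Vec.map head us) i
    same i rewrite lookup-map (ι i) head ts | lookup-map i head us = decodes-head (carried c i)

  carries-act : ∀ {ts us} s as → Carries ts us → Carries (Vec.zipWith act (host s as) ts) (Vec.zipWith act as us)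
  carries-act {ts} {us} s as c .carried i
    rewrite lookup-zipWith act (ι i) (host s as) ts | lookup-zipWith act i as us | lookup-host s as i
    = decodes-act (proj₂ (Vec.lookup as i)) (carried c i) (dec-emb D (proj₁ (Vec.lookup as i)))

  lookup-idle : ∀ ts as {j} → ρ j ≡ nothing →
                Vec.lookup (Vec.zipWith act (host (Vec.map head ts) as) ts) j ≡ Vec.lookup ts j
  lookup-idle ts as {j} e = begin
    Vec.lookup (Vec.zipWith act (host (Vec.map head ts) as) ts) j
      ≡⟨ lookup-zipWith act j (host (Vec.map head ts) as) ts ⟩
    act (Vec.lookup (host (Vec.map head ts) as) j) (Vec.lookup ts j)
      ≡⟨ cong (λ a → act a (Vec.lookup ts j)) (lookup∘tabulate _ j) ⟩
    act (hostAct (Vec.lookup (Vec.map head ts) j) (ρ j) as) (Vec.lookup ts j)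
      ≡⟨ cong₂ (λ s r → act (hostAct s r as) (Vec.lookup ts j)) (lookup-map j head ts) e ⟩
    act (hostAct (head (Vec.lookup ts j)) nothing as) (Vec.lookup ts j)
      ≡⟨⟩
    Vec.lookup ts j ∎
    where open ≡-Reasoning

  orElse-[] : ∀ {l} s l′ → l ≡ [] → orElse (map (lift s) l) l′ ≡ l′
  orElse-[] s l′ refl = refl

  orElse-≢[] : ∀ {l} s l′ → ¬ l ≡ [] → orElse (map (lift s) l) l′ ≡ map (lift s) l
  orElse-≢[] {[]}    s l′ l≢[] = ⊥-elim (l≢[] refl)
  orElse-≢[] {_ ∷ _} s l′ l≢[] = refl

  δ-view : ∀ {ts us} q → Carries ts us → δ q (view (Vec.map head ts)) ≡ δ q (Vec.map head us)
  δ-view q c = cong (δ q) (view-heads c)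

  δ-host-halted : ∀ {q ts us} → Carries ts us → TM.Halted M (config q us) →
                  δ-host q (Vec.map head ts) ≡ exit q (Vec.map head ts)
  δ-host-halted {q} {ts} c h =
    orElse-[] (Vec.map head ts) (exit q (Vec.map head ts)) (trans (δ-view q c) (map-≡[] h))

  δ-host-step : ∀ {q ts us} → Carries ts us → ¬ TM.Halted M (config q us) →
                δ-host q (Vec.map head ts) ≡ map (lift (Vec.map head ts)) (δ q (Vec.map head us))
  δ-host-step {q} {ts} {us} c ¬h =
    trans (orElse-≢[] (Vec.map head ts) (exit q (Vec.map head ts)) λ e →
             ¬h (cong (results us) (trans (sym (δ-view q c)) e)))
          (cong (map (lift (Vec.map head ts))) (δ-view q c))

  -- Idle tapes are required to equal those of `ts₀`, so that data parked there, such as the counter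
  -- in `Query`, is intact when the guest halts.
  data Hosts (ts₀ : Vec (Tape Y) n) : TM.Config M → Configuration Q Y n → Set where
    hosts : ∀ {q ts us} → Carries ts us → (∀ j → ρ j ≡ nothing → Vec.lookup ts j ≡ Vec.lookup ts₀ j) →
            Hosts ts₀ (config q us) (config (run q) ts)

  hosts-step : ∀ {ts₀ q ts us} → Hosts ts₀ (config q us) (config (run q) ts) → ¬ TM.Halted M (config q us) →
               Pointwise (Hosts ts₀) (TM.successors M (config q us)) (results ts (δ-host q (Vec.map head ts)))
  hosts-step {ts₀} {q} {ts} {us} (hosts c idle) ¬h
    rewrite δ-host-step c ¬h
          | sym (map-∘ {g = λ (q , as) → config q (Vec.zipWith act as ts)} {lift (Vec.map head ts)} (δ q (Vec.map head us)))
    = pointwise-map (λ (q′ , as) → hosts (carries-act (Vec.map head ts) as c)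
                                     (λ j e → trans (lookup-idle ts as e) (idle j e)))
        (δ q (Vec.map head us))

-- Guessing which of two machines accepts

outputOf : ∀ {Q X n} → Configuration Q X (suc n) → ℕ
outputOf c = binaryValue (leadingBits (head t ∷ after t))
  where t = Vec.head (tapes c)

outputs : ∀ (M : TM) → TM.Config M → List ℕ
outputs M c = if TM.accepting M (state c) then [ outputOf c ] else []

after-move-left : ∀ {X} (t : Tape X) → after (move left t) ≡ head t ∷ after t
after-move-left (tape []      s r) = refl
after-move-left (tape (a ∷ l) s r) = refl

binaryValue-digit : ∀ b → binaryValue [ b ] ≡ digit b
binaryValue-digit false = refl
binaryValue-digit true  = refl

-- If exactly one of the two machines accepts, guessing which one computes the
-- characteristic function of the first as the output of the only accepting path.
module Choice (M₁ M₂ : TM) where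
  module M₁ = TM M₁
  module M₂ = TM M₂

  Q X : Set
  Q = ⊤ ⊎ ((M₁.State ⊎ M₂.State) ⊎ (Bool ⊎ ⊤))
  X = M₁.Aux ⊎ M₂.Aux

  pattern choose   = inj₁ tt
  pattern run₁ q   = inj₂ (inj₁ (inj₁ q))
  pattern run₂ q   = inj₂ (inj₁ (inj₂ q))
  pattern answer b = inj₂ (inj₂ (inj₁ b))
  pattern done     = inj₂ (inj₂ (inj₂ tt))

  Symbols Transitions : Set
  Symbols = Vec (Symbol X) (suc (M₁.k + M₂.k))
  Transitions = List (Q × Vec (Symbol X × Move) (suc (M₁.k + M₂.k)))

  -- The output extends from the head to the first cell without a bit, and the guest may have left
  -- bits there. So a blank is written first and the answer goes into the cell to its left.
  answering : Bool → Bool → Symbols → Transitions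
  answering b false s       = []
  answering b true  (_ ∷ s) = [ (answer b , (blank , left) ∷ Vec.map (_, stay) s) ]

  -- The guests share the input tape, which is safe because each path runs only one of them; their
  -- work tapes lie side by side.
  ι₁ : Fin (suc M₁.k) → Fin (suc (M₁.k + M₂.k))
  ι₁ zero    = zero
  ι₁ (suc i) = suc (i Fin.↑ˡ M₂.k)

  ι₂ : Fin (suc M₂.k) → Fin (suc (M₁.k + M₂.k))
  ι₂ zero    = zero
  ι₂ (suc i) = suc (M₁.k Fin.↑ʳ i)

  ρ₁ : Fin (suc (M₁.k + M₂.k)) → Maybe (Fin (suc M₁.k))
  ρ₁ zero    = just zero
  ρ₁ (suc j) = [ just ∘ suc , (λ _ → nothing) ]′ (Fin.splitAt M₁.k j)

  ρ₂ : Fin (suc (M₁.k + M₂.k)) → Maybe (Fin (suc M₂.k))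
  ρ₂ zero    = just zero
  ρ₂ (suc j) = [ (λ _ → nothing) , just ∘ suc ]′ (Fin.splitAt M₁.k j)

  ρ₁-ι₁ : ∀ i → ρ₁ (ι₁ i) ≡ just i
  ρ₁-ι₁ zero    = refl
  ρ₁-ι₁ (suc i) = cong [ just ∘ suc , (λ _ → nothing) ]′ (splitAt-↑ˡ M₁.k i M₂.k)

  ρ₂-ι₂ : ∀ i → ρ₂ (ι₂ i) ≡ just i
  ρ₂-ι₂ zero    = refl
  ρ₂-ι₂ (suc i) = cong [ (λ _ → nothing) , just ∘ suc ]′ (splitAt-↑ʳ M₁.k M₂.k i)

  module H₁ = Host M₁ {X} injection₁ ι₁ ρ₁ ρ₁-ι₁ {Q} (λ q → run₁ q) (λ q → answering true (M₁.accepting q))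
  module H₂ = Host M₂ {X} injection₂ ι₂ ρ₂ ρ₂-ι₂ {Q} (λ q → run₂ q) (λ q → answering false (M₂.accepting q))

  δ′ : Q → Symbols → Transitions
  δ′ choose     s       = (run₁ M₁.start , Vec.map (_, stay) s) ∷ (run₂ M₂.start , Vec.map (_, stay) s) ∷ []
  δ′ (run₁ q)   s       = H₁.δ-host q s
  δ′ (run₂ q)   s       = H₂.δ-host q s
  δ′ (answer b) (_ ∷ s) = [ (done , (bit b , stay) ∷ Vec.map (_, stay) s) ]
  δ′ done       s       = []

  answering-unique : ∀ b a s → Unique (answering b a s)
  answering-unique b false s       = []
  answering-unique b true  (_ ∷ s) = [] ∷ []

  δ′-unique : ∀ q s → Unique (δ′ q s)
  δ′-unique choose     s       = ((λ ()) ∷ []) ∷ [] ∷ []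
  δ′-unique (run₁ q)   s       = H₁.δ-host-unique (λ { refl → refl }) q s (answering-unique true (M₁.accepting q) s)
  δ′-unique (run₂ q)   s       = H₂.δ-host-unique (λ { refl → refl }) q s (answering-unique false (M₂.accepting q) s)
  δ′-unique (answer b) (_ ∷ s) = [] ∷ []
  δ′-unique done       s       = []

  machine : TM
  machine = record
    { k          = M₁.k + M₂.k
    ; Aux        = X
    ; State      = Q
    ; aux-finite = ⊎-finite M₁.aux-finite M₂.aux-finite
    ; st-finite  = ⊎-finite ⊤-finite
                     (⊎-finite (⊎-finite M₁.st-finite M₂.st-finite) (⊎-finite Bool-finite ⊤-finite))
    ; start      = choose
    ; accepting  = λ { done → true ; _ → false }
    ; δ          = δ′
    ; δ-unique   = δ′-unique
    }

  answer-output : ∀ b (t : Tape X) →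
                  binaryValue (leadingBits (bit b ∷ after (move left (write blank t)))) ≡ digit b
  answer-output b t rewrite after-move-left (write blank t) = binaryValue-digit b

  answer-run : ∀ b ts → Run machine (outputs machine) 1
                 (config (answer b) (Vec.zipWith act ((blank , left) ∷ Vec.map (_, stay) (Vec.map head (Vec.tail ts))) ts))
                 [ digit b ]
  answer-run b (t ∷ ts) = step₁ machine (outputs machine) refl
    (subst (Run machine (outputs machine) 0 _) (cong [_] (answer-output b t)) (halt refl))

  exit-run : ∀ {q ts} b a → TM.accepting machine q ≡ false →
             δ′ q (Vec.map head ts) ≡ answering b a (Vec.map head ts) →
             Run machine (outputs machine) 2 (config q ts) (if a then [ digit b ] else [])
  exit-run {q} {ts} b false ¬acc e = subst (Run machine (outputs machine) 2 _) none (halt (successors-≡ machine {q} e))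
    where
    none : outputs machine (config q ts) ≡ []
    none rewrite ¬acc = refl
  exit-run {q} {t ∷ ts} b true ¬acc e =
    step₁ machine (outputs machine) (successors-≡ machine {q} e) (answer-run b (t ∷ ts))

  value₁ : M₁.Config → List ℕ
  value₁ c = if M₁.accepting (state c) then [ 1 ] else []

  value₂ : M₂.Config → List ℕ
  value₂ c = if M₂.accepting (state c) then [ 0 ] else []

  halted₁ : ∀ {ts₀ c d} → H₁.Hosts ts₀ c d → M₁.Halted c → Run machine (outputs machine) 2 d (value₁ c)
  halted₁ (H₁.hosts {q} c _) h = exit-run true (M₁.accepting q) refl (H₁.δ-host-halted c h)

  halted₂ : ∀ {ts₀ c d} → H₂.Hosts ts₀ c d → M₂.Halted c → Run machine (outputs machine) 2 d (value₂ c)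
  halted₂ (H₂.hosts {q} c _) h = exit-run false (M₂.accepting q) refl (H₂.δ-host-halted c h)

  step-hosts₁ : ∀ {ts₀ c d} → H₁.Hosts ts₀ c d → ¬ M₁.Halted c →
                Pointwise (H₁.Hosts ts₀) (M₁.successors c) (TM.successors machine d)
  step-hosts₁ r@(H₁.hosts _ _) = H₁.hosts-step r

  step-hosts₂ : ∀ {ts₀ c d} → H₂.Hosts ts₀ c d → ¬ M₂.Halted c →
                Pointwise (H₂.Hosts ts₀) (M₂.successors c) (TM.successors machine d)
  step-hosts₂ r@(H₂.hosts _ _) = H₂.hosts-step r

  module S₁ (ts₀ : Vec (Tape X) (suc (M₁.k + M₂.k))) =
    Simulation M₁ machine value₁ (outputs machine) (H₁.Hosts ts₀) 2 halted₁ step-hosts₁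
  module S₂ (ts₀ : Vec (Tape X) (suc (M₁.k + M₂.k))) =
    Simulation M₂ machine value₂ (outputs machine) (H₂.Hosts ts₀) 2 halted₂ step-hosts₂

  initialTapes : Word → Vec (Tape X) (suc (M₁.k + M₂.k))
  initialTapes x = inputTape x ∷ Vec.replicate (M₁.k + M₂.k) blankTape

  initially₁ : ∀ x → H₁.Carries (initialTapes x) (tapes (M₁.initial x))
  initially₁ x .H₁.Carries.carried zero = decodes-inputTape injection₁ x
  initially₁ x .H₁.Carries.carried (suc i)
    rewrite lookup-replicate {n = M₁.k + M₂.k} (i Fin.↑ˡ M₂.k) (blankTape {X})
          | lookup-replicate {n = M₁.k} i (blankTape {M₁.Aux}) = decodes-inputTape injection₁ []

  initially₂ : ∀ x → H₂.Carries (initialTapes x) (tapes (M₂.initial x))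
  initially₂ x .H₂.Carries.carried zero = decodes-inputTape injection₂ x
  initially₂ x .H₂.Carries.carried (suc i)
    rewrite lookup-replicate {n = M₁.k + M₂.k} (M₁.k Fin.↑ʳ i) (blankTape {X})
          | lookup-replicate {n = M₂.k} i (blankTape {M₂.Aux}) = decodes-inputTape injection₂ []

  -- One step for the guess and two for writing the answer. The sum of the running times stands in
  -- for their maximum, as sums of polynomials are polynomials.
  choice-run : ∀ {t₁ t₂ vs₁ vs₂} x → Run M₁ value₁ t₁ (M₁.initial x) vs₁ → Run M₂ value₂ t₂ (M₂.initial x) vs₂ →
               Run machine (outputs machine) (suc (t₁ + t₂ + 2)) (TM.initial machine x) (vs₁ ++ vs₂)
  choice-run {t₁} {t₂} x r₁ r₂ =
    step₂ machine (outputs machine)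
      (cong₂ (λ ts ts′ → config (run₁ M₁.start) ts ∷ config (run₂ M₂.start) ts′ ∷ [])
        (act-idle (initialTapes x)) (act-idle (initialTapes x)))
      (run-mono machine (outputs machine) (+-monoˡ-≤ 2 (m≤m+n t₁ t₂))
        (S₁.simulate (initialTapes x) (H₁.hosts (initially₁ x) (λ _ _ → refl)) r₁))
      (run-mono machine (outputs machine) (+-monoˡ-≤ 2 (m≤n+m t₂ t₁))
        (S₂.simulate (initialTapes x) (H₂.hosts (initially₂ x) (λ _ _ → refl)) r₂))

-- From `UPSVₜ ⊆ TotP` to `UP ∩ coUP ⊆ P`

map-≡[_] : ∀ {A B : Set} {h : A → B} {xs v} → map h xs ≡ [ v ] → ∃[ x ] (xs ≡ [ x ] × h x ≡ v)
map-≡[_] {xs = x ∷ []} refl = x , refl , refl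

map-const-1 : ∀ {A B : Set} {b : B} (xs : List A) → length xs ≡ 1 → map (λ _ → b) xs ≡ [ b ]
map-const-1 (x ∷ []) _ = refl

map-const-0 : ∀ {A B : Set} {b : B} (xs : List A) → length xs ≡ 0 → map (λ _ → b) xs ≡ []
map-const-0 [] _ = refl

length-concatMap-[tt] : ∀ {A : Set} (xs : List A) → length (concatMap (λ _ → [ tt ]) xs) ≡ length xs
length-concatMap-[tt] []       = refl
length-concatMap-[tt] (x ∷ xs) = cong suc (length-concatMap-[tt] xs)

outputs-UPSVₜ : ∀ {f} M → (∀ x → concatMap (outputs (NPTM.machine M)) (NPTM.paths M x) ≡ [ f x ]) → UPSVₜ f
outputs-UPSVₜ M e =
  M , λ x → map-≡[_] (trans (sym (concatMap-if (λ c → NPTM.accepting M (state c)) outputOf (NPTM.paths M x))) (e x))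

module _ {L : Language} (M₁ M₂ : NPTM)
  (spec₁ : ∀ x → (L x → NPTM.acc M₁ x ≡ 1) × (¬ L x → NPTM.acc M₁ x ≡ 0))
  (spec₂ : ∀ x → (¬ L x → NPTM.acc M₂ x ≡ 1) × (¬ ¬ L x → NPTM.acc M₂ x ≡ 0)) where

  open Choice (NPTM.machine M₁) (NPTM.machine M₂) using (value₁; value₂; machine; choice-run)

  -- Membership in L may be undecidable, but the conclusion is a decidable statement about two
  -- numbers. It is therefore stable under double negation, and a refutation may distinguish the
  -- cases of L.
  exactlyOne : ∀ x → (NPTM.acc M₁ x ≡ 1 × NPTM.acc M₂ x ≡ 0) ⊎ (NPTM.acc M₁ x ≡ 0 × NPTM.acc M₂ x ≡ 1)
  exactlyOne x = decidable-stable
    (((NPTM.acc M₁ x ≟ 1) ×-dec (NPTM.acc M₂ x ≟ 0)) ⊎-dec ((NPTM.acc M₁ x ≟ 0) ×-dec (NPTM.acc M₂ x ≟ 1)))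
    λ neither →
      let x∉L = λ x∈L → neither (inj₁ (proj₁ (spec₁ x) x∈L , proj₂ (spec₂ x) (λ x∉L → x∉L x∈L)))
      in neither (inj₂ (proj₂ (spec₁ x) x∉L , proj₁ (spec₂ x) x∉L))

  values : ∀ x → concatMap value₁ (NPTM.paths M₁ x) ++ concatMap value₂ (NPTM.paths M₂ x) ≡ [ NPTM.acc M₁ x ]
  values x
    rewrite concatMap-if (λ c → NPTM.accepting M₁ (state c)) (λ _ → 1) (NPTM.paths M₁ x)
          | concatMap-if (λ c → NPTM.accepting M₂ (state c)) (λ _ → 0) (NPTM.paths M₂ x)
    with exactlyOne x
  ... | inj₁ (one , none) rewrite map-const-1 {b = 1} (NPTM.acceptingPaths M₁ x) one
                                | map-const-0 {b = 0} (NPTM.acceptingPaths M₂ x) none = cong [_] (sym one)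
  ... | inj₂ (none , one) rewrite map-const-0 {b = 1} (NPTM.acceptingPaths M₁ x) none
                                | map-const-1 {b = 0} (NPTM.acceptingPaths M₂ x) one = cong [_] (sym none)

  acc-UPSVₜ : UPSVₜ (NPTM.acc M₁)
  acc-UPSVₜ = outputs-UPSVₜ (clocked machine (outputs machine) poly run)
    λ x → trans (clocked-values machine (outputs machine) poly run x) (values x)
    where
    poly : IsPolynomial (λ n → suc (eval (NPTM.bound M₁) n + eval (NPTM.bound M₂) n + 2))
    poly = +-isPolynomial (const-isPolynomial 1)
             (+-isPolynomial (+-isPolynomial (eval-isPolynomial (NPTM.bound M₁)) (eval-isPolynomial (NPTM.bound M₂)))
               (const-isPolynomial 2))

    run : ∀ x → Run machine (outputs machine) _ (TM.initial machine x) _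
    run x = choice-run x (paths-run M₁ value₁ x) (paths-run M₂ value₂ x)

  TotP-P : TotP (NPTM.acc M₁) → P L
  TotP-P (M , acc≡tot) = D , (λ q s → B.δ′-short q s) , λ x → in-L x , out-L x
    where
    module B = Branching (NPTM.machine M)

    branches : Word → List ⊤
    branches x = concatMap (λ _ → [ tt ]) (NPTM.paths M x)

    run : ∀ x → Run B.machine (verdict B.machine) _ (TM.initial B.machine x) (B.several (branches x))
    run x = B.branching-run (paths-run M (λ _ → [ tt ]) x)

    D : NPTM
    D = clocked B.machine (verdict B.machine) (eval-isPolynomial (NPTM.bound M)) run

    acc-D : ∀ x → NPTM.acc D x ≡ length (B.several (branches x))
    acc-D = acc-clocked B.machine (eval-isPolynomial (NPTM.bound M)) run

    -- `several` only separates one leaf from more than one, so it agrees with the number of leaves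
    -- minus one up to the value 1, which is all that `acc M₁` attains.
    length-several : ∀ us n → length us ∸ 1 ≡ n → n ≤ 1 → length (B.several us) ≡ n
    length-several []              zero       _ _ = refl
    length-several (_ ∷ [])        zero       _ _ = refl
    length-several (_ ∷ _ ∷ [])    (suc zero) _ _ = refl
    length-several (_ ∷ _ ∷ _ ∷ _) (suc (suc _)) _ (s≤s ())

    acc-D≡acc-M₁ : ∀ x → NPTM.acc M₁ x ≤ 1 → NPTM.acc D x ≡ NPTM.acc M₁ x
    acc-D≡acc-M₁ x ≤1 = trans (acc-D x) (length-several (branches x) _
      (trans (cong (_∸ 1) (length-concatMap-[tt] (NPTM.paths M x))) (sym (acc≡tot x))) ≤1)

    in-L : ∀ x → L x → 0 < NPTM.acc D x
    in-L x x∈L = ≤-reflexive (sym (trans (acc-D≡acc-M₁ x (≤-reflexive one)) one))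
      where one = proj₁ (spec₁ x) x∈L

    out-L : ∀ x → ¬ L x → NPTM.acc D x ≡ 0
    out-L x x∉L = trans (acc-D≡acc-M₁ x (≤-trans (≤-reflexive none) z≤n)) none
      where none = proj₂ (spec₁ x) x∉L

UPSVₜ⊆TotP⇒UP∩coUP⊆P : (UPSVₜ ⊆ TotP) → (UP ∩ coUP) ⊆ P
UPSVₜ⊆TotP⇒UP∩coUP⊆P UPSVₜ⊆TotP {L} ((M₁ , spec₁) , (M₂ , spec₂)) =
  TotP-P {L} M₁ M₂ spec₁ spec₂ (UPSVₜ⊆TotP (acc-UPSVₜ {L} M₁ M₂ spec₁ spec₂))

-- The bits of a function value as a language

leadingBits-look : ∀ {X} (ss ts : List (Symbol X)) → (∀ n → look ss n ≡ look ts n) →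
                   leadingBits ss ≡ leadingBits ts
leadingBits-look []       []       e = refl
leadingBits-look []       (t ∷ ts) e with refl ← e 0 = refl
leadingBits-look (s ∷ ss) []       e with refl ← e 0 = refl
leadingBits-look (s ∷ ss) (t ∷ ts) e with refl ← e 0 with s
... | blank = refl
... | bit b = cong (b ∷_) (leadingBits-look ss ts (λ n → e (suc n)))
... | aux _ = refl

tapeBits : ∀ {X} → Tape X → Word
tapeBits t = leadingBits (head t ∷ after t)

tapeBits-decodes : ∀ {X} {t u : Tape X} → Decodes id t u → tapeBits t ≡ tapeBits u
tapeBits-decodes {t = t} {u} t~u = leadingBits-look (head t ∷ after t) (head u ∷ after u)
  λ { zero → decode t~u (pos 0) ; (suc n) → decode t~u (pos (suc n)) }

tapeBits-right : ∀ {X} (t : Tape X) → tapeBits (move right t) ≡ leadingBits (after t)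
tapeBits-right (tape l s [])      = refl
tapeBits-right (tape l s (a ∷ r)) = refl

-- Question 2j asks whether a word has a bit number j, question 2j + 1 asks for that bit.
answer : Bool → ℕ → Word → Bool
answer odd   i       []      = false
answer false zero    (c ∷ o) = true
answer true  zero    (c ∷ o) = c
answer false (suc i) (c ∷ o) = answer true i (c ∷ o)
answer true  (suc i) (c ∷ o) = answer false i o

-- The question number stands in unary before x, closed off by `false`, so the next question needs
-- one more `true` in front. Unary is affordable because only polynomially many questions are asked.
encode : Word → ℕ → Word
encode x zero    = false ∷ x
encode x (suc i) = true ∷ encode x i

-- The accumulator mirrors the counter that the machine of `Query` builds while scanning.
query : (Word → Word) → ℕ → Word → Bool
query out i []          = false
query out i (true ∷ w)  = query out (suc i) w
query out i (false ∷ x) = answer false i (out x)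

query-encode : ∀ out x m i → query out i (encode x m) ≡ answer false (m + i) (out x)
query-encode out x zero    i = refl
query-encode out x (suc m) i =
  trans (query-encode out x m (suc i)) (cong (λ j → answer false j (out x)) (+-suc m i))

-- One construction serves the language and its complement. When M has exactly one accepting path,
-- exactly one path ends in a `done` state, and it holds the answer; `positive` selects which
-- answers are accepted.
module Query (M : NPTM) (positive : Bool) where
  open NPTM M using (k; Aux; State; accepting)

  Q : Set
  Q = ⊤ ⊎ (State ⊎ (Bool ⊎ Bool))

  pattern scan     = inj₁ tt
  pattern run q    = inj₂ (inj₁ q)
  pattern walk odd = inj₂ (inj₂ (inj₁ odd))
  pattern done a   = inj₂ (inj₂ (inj₂ a))

  Symbols Transitions : Set
  Symbols = Vec (Symbol Aux) (suc (suc k))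
  Transitions = List (Q × Vec (Symbol Aux × Move) (suc (suc k)))

  ι : Fin (suc k) → Fin (suc (suc k))
  ι zero    = zero
  ι (suc i) = suc (suc i)

  ρ : Fin (suc (suc k)) → Maybe (Fin (suc k))
  ρ zero          = just zero
  ρ (suc zero)    = nothing
  ρ (suc (suc i)) = just (suc i)

  ρ-ι : ∀ i → ρ (ι i) ≡ just i
  ρ-ι zero    = refl
  ρ-ι (suc i) = refl

  exit : Bool → Symbols → Transitions
  exit true  s = [ (walk false , Vec.map (_, stay) s) ]
  exit false s = []

  module H = Host (NPTM.machine M) {Aux} identical ι ρ ρ-ι {Q} (λ q → run q) (λ q → exit (accepting q))

  -- The prefix is blanked because M must find blanks to the left of its input. The counter's head
  -- stands one cell past the last mark, so on `false` it steps back; it then reads a mark exactly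
  -- if the count is positive.
  scanning : Symbols → Q × Vec (Symbol Aux × Move) (suc (suc k))
  scanning (bit true  ∷ s′ ∷ s) = scan , (blank , right) ∷ (bit true , right) ∷ Vec.map (_, stay) s
  scanning (bit false ∷ s′ ∷ s) = run (NPTM.start M) , (blank , right) ∷ (s′ , left) ∷ Vec.map (_, stay) s
  scanning s                    = done false , Vec.map (_, stay) s

  -- Each question uses up a mark, but the output tape advances only after an odd one, since
  -- questions 2j and 2j + 1 concern the same bit.
  walking : Bool → Symbols → Q × Vec (Symbol Aux × Move) (suc (suc k))
  walking false (bit c ∷ bit d ∷ s) = walk true , (bit c , stay) ∷ (bit d , left) ∷ Vec.map (_, stay) s
  walking true  (bit c ∷ bit d ∷ s) = walk false , (bit c , right) ∷ (bit d , left) ∷ Vec.map (_, stay) s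
  walking false (bit c ∷ s)         = done true , Vec.map (_, stay) (bit c ∷ s)
  walking true  (bit c ∷ s)         = done c , Vec.map (_, stay) (bit c ∷ s)
  walking odd   s                   = done false , Vec.map (_, stay) s

  δ′ : Q → Symbols → Transitions
  δ′ scan       s = [ scanning s ]
  δ′ (run q)    s = H.δ-host q s
  δ′ (walk odd) s = [ walking odd s ]
  δ′ (done a)   s = []

  exit-unique : ∀ a s → Unique (exit a s)
  exit-unique false s = []
  exit-unique true  s = [] ∷ []

  δ′-unique : ∀ q s → Unique (δ′ q s)
  δ′-unique scan       s = [] ∷ []
  δ′-unique (run q)    s = H.δ-host-unique (λ { refl → refl }) q s (exit-unique (accepting q) s)
  δ′-unique (walk odd) s = [] ∷ []
  δ′-unique (done a)   s = []

  verdicts : Bool → List ⊤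
  verdicts a = if (if positive then a else not a) then [ tt ] else []

  machine : TM
  machine = record
    { k          = suc k
    ; Aux        = Aux
    ; State      = Q
    ; aux-finite = NPTM.aux-finite M
    ; st-finite  = ⊎-finite ⊤-finite (⊎-finite (NPTM.st-finite M) (⊎-finite Bool-finite Bool-finite))
    ; start      = scan
    ; accepting  = λ { (done a) → if positive then a else not a ; _ → false }
    ; δ          = δ′
    ; δ-unique   = δ′-unique
    }

  RunQ : ℕ → TM.Config machine → List ⊤ → Set
  RunQ = Run machine (verdict machine)

  -- A unary counter, read from the head to the left.
  Counter : ℕ → Tape Aux → Set
  Counter zero    t = head t ≡ blank
  Counter (suc i) t = head t ≡ bit true × before t ≡ List.replicate i (bit true)

  counter-left : ∀ i (t : Tape Aux) → before t ≡ List.replicate i (bit true) → Counter i (move left t)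
  counter-left zero    (tape [] s r) refl = refl
  counter-left (suc i) (tape _  s r) refl = refl , refl

  done-run : ∀ {t} a {ts} → RunQ t (config (done a) ts) (verdicts a)
  done-run a = halt refl

  idle₂ : ∀ {q t t′} (ts : Vec (Tape Aux) k) →
          [ config {Q} q (t ∷ t′ ∷ Vec.zipWith act (Vec.map (_, stay) (Vec.map head ts)) ts) ] ≡
          [ config q (t ∷ t′ ∷ ts) ]
  idle₂ ts = cong (λ ts → [ config _ (_ ∷ _ ∷ ts) ]) (act-idle ts)

  walk-run : ∀ odd i t {t′ ts} → Counter i t′ →
             RunQ (suc i) (config (walk odd) (t ∷ t′ ∷ ts)) (verdicts (answer odd i (tapeBits t)))
  walk-run false i (tape l blank r)   {ts = ts} c = step₁ machine (verdict machine) (idle₂ ts) (done-run false)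
  walk-run true  i (tape l blank r)   {ts = ts} c = step₁ machine (verdict machine) (idle₂ ts) (done-run false)
  walk-run false i (tape l (aux a) r) {ts = ts} c = step₁ machine (verdict machine) (idle₂ ts) (done-run false)
  walk-run true  i (tape l (aux a) r) {ts = ts} c = step₁ machine (verdict machine) (idle₂ ts) (done-run false)
  walk-run false zero (tape l (bit b) r) {ts = ts} refl = step₁ machine (verdict machine) (idle₂ ts) (done-run true)
  walk-run true  zero (tape l (bit b) r) {ts = ts} refl = step₁ machine (verdict machine) (idle₂ ts) (done-run b)
  walk-run false (suc i) t@(tape l (bit b) r) {tape _ _ _} {ts} (refl , refl) =
    step₁ machine (verdict machine) (idle₂ ts) (walk-run true i t (counter-left i _ refl))
  walk-run true  (suc i) t@(tape l (bit b) r) {tape _ _ _} {ts} (refl , refl) rewrite sym (tapeBits-right t) =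
    step₁ machine (verdict machine) (idle₂ ts) (walk-run false i (move right t) (counter-left i _ refl))

  value : ℕ → NPTM.Config M → List ⊤
  value i c = if accepting (state c) then verdicts (answer false i (tapeBits (Vec.head (tapes c)))) else []

  exit-run : ∀ {q t i t′ ts} a → H.δ-host q (Vec.map head (t ∷ t′ ∷ ts)) ≡ exit a (Vec.map head (t ∷ t′ ∷ ts)) →
             Counter i t′ →
             RunQ (2 + i) (config (run q) (t ∷ t′ ∷ ts)) (if a then verdicts (answer false i (tapeBits t)) else [])
  exit-run {q} false e count = halt (successors-≡ machine {run q} e)
  exit-run {q} {t} {i} {t′} {ts} true e count =
    step₁ machine (verdict machine) (trans (successors-≡ machine {run q} e) (idle₂ ts)) (walk-run false i t count)

  halted-run : ∀ {i t t′ ts c d} → Counter i t′ → H.Hosts (t ∷ t′ ∷ ts) c d → NPTM.Halted M c →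
               RunQ (2 + i) d (value i c)
  halted-run {i} count (H.hosts {q} {_ ∷ _ ∷ _} {u ∷ us} c idle) h =
    subst (λ o → RunQ (2 + i) _ (if accepting q then verdicts (answer false i o) else []))
      (tapeBits-decodes (H.Carries.carried c zero))
      (exit-run (accepting q) (H.δ-host-halted c h) (subst (Counter i) (sym (idle (suc zero) refl)) count))

  step-hosts : ∀ {ts₀ c d} → H.Hosts ts₀ c d → ¬ NPTM.Halted M c →
               Pointwise (H.Hosts ts₀) (NPTM.successors M c) (TM.successors machine d)
  step-hosts r@(H.hosts _ _) = H.hosts-step r

  module S (i : ℕ) (t t′ : Tape Aux) (ts : Vec (Tape Aux) k) (count : Counter i t′) =
    Simulation (NPTM.machine M) machine (value i) (verdict machine) (H.Hosts (t ∷ t′ ∷ ts)) (2 + i)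
      (halted-run count) step-hosts

  module _ {out : Word → Word}
    (out-spec : ∀ x → ∃[ c ] (NPTM.acceptingPaths M x ≡ [ c ] × tapeBits (Vec.head (tapes c)) ≡ out x)) where

    paths-value : ∀ i x → concatMap (value i) (NPTM.paths M x) ≡ verdicts (answer false i (out x))
    paths-value i x with out-spec x
    ... | c , e , e′ = trans (concatMap-filter (λ c → accepting (state c)) _ (NPTM.paths M x))
      (trans (cong (concatMap _) e) (trans (++-identityʳ _) (cong (verdicts ∘ answer false i) e′)))

    run-run : ∀ i x {t t′} → Decodes id t (inputTape x) → Counter i t′ →
              RunQ (eval (NPTM.bound M) (length x) + (2 + i))
                (config (run (NPTM.start M)) (t ∷ t′ ∷ Vec.replicate k blankTape)) (verdicts (answer false i (out x)))
    run-run i x {t} {t′} t~x count =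
      subst (RunQ _ _) (paths-value i x)
        (S.simulate i t t′ _ count (H.hosts initially (λ _ _ → refl)) (paths-run M (value i) x))
      where
      initially : H.Carries (t ∷ t′ ∷ Vec.replicate k blankTape) (tapes (NPTM.initial M x))
      initially .H.Carries.carried zero    = t~x
      initially .H.Carries.carried (suc i) .decode z = refl

    -- N stands for the length of the whole query word. Scanning a `true` moves one unit from
    -- `length w` to `i`, so N keeps bounding their sum, hence also the length of x and the marks to
    -- walk off.
    scan-run : ∀ {N} w i {t t′} → i + length w ≤ N → Decodes id t (inputTape w) →
               before t′ ≡ List.replicate i (bit true) →
               RunQ (length w + (eval (NPTM.bound M) N + (3 + N)))
                 (config scan (t ∷ t′ ∷ Vec.replicate k blankTape)) (verdicts (query out i w))
    scan-run {N} [] i {tape l s r} i≤N t~w e with refl ← decodes-head t~w =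
      run-mono machine (verdict machine) (m≤n+m (3 + N) (eval (NPTM.bound M) N))
        (step₁ machine (verdict machine) (idle₂ (Vec.replicate k blankTape)) (done-run false))
    scan-run (true ∷ w) i {tape l s r} {tape l′ s′ r′} i≤N t~w e with refl ← decodes-head t~w =
      step₁ machine (verdict machine) (idle₂ (Vec.replicate k blankTape))
        (scan-run w (suc i) (≤-trans (≤-reflexive (sym (+-suc i (length w)))) i≤N)
          (decodes-unprepend identical t~w) (trans (before-right (tape l′ (bit true) r′)) (cong (bit true ∷_) e)))
      where
      before-right : ∀ (t : Tape Aux) → before (move right t) ≡ head t ∷ before t
      before-right (tape _ _ [])      = refl
      before-right (tape _ _ (_ ∷ _)) = refl
    scan-run {N} (false ∷ x) i {tape l s r} {t′} i≤N t~w e with refl ← decodes-head t~w =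
      step₁ machine (verdict machine) (idle₂ (Vec.replicate k blankTape))
        (run-mono machine (verdict machine) (≤-trans bound (m≤n+m _ (length x)))
          (run-run i x (decodes-unprepend identical t~w) (counter-left i t′ e)))
      where
      bound : eval (NPTM.bound M) (length x) + (2 + i) ≤ eval (NPTM.bound M) N + (3 + N)
      bound = +-mono-≤ (eval-mono (NPTM.bound M) (≤-trans (n≤1+n _) (≤-trans (m≤n+m _ i) i≤N)))
                (s≤s (s≤s (≤-trans (m≤m+n i _) (≤-trans i≤N (n≤1+n _)))))

    query-run : ∀ w → RunQ (length w + (eval (NPTM.bound M) (length w) + (3 + length w))) (TM.initial machine w)
                        (verdicts (query out 0 w))
    query-run w = scan-run w 0 ≤-refl (decodes-inputTape identical w) refl

    poly : IsPolynomial (λ n → n + (eval (NPTM.bound M) n + (3 + n)))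
    poly = +-isPolynomial id-isPolynomial
             (+-isPolynomial (eval-isPolynomial (NPTM.bound M)) (+-isPolynomial (const-isPolynomial 3) id-isPolynomial))

    decider : NPTM
    decider = clocked machine (verdict machine) poly query-run

    acc-decider : ∀ w → NPTM.acc decider w ≡ length (verdicts (query out 0 w))
    acc-decider = acc-clocked machine poly query-run

-- Queries to a deterministic machine, undone from a log

module Querying (D : NPTM) (deterministic : NPTM.Deterministic D) where
  open NPTM D using (k; Aux; State; δ; accepting)

  -- A log entry is one tape symbol holding, for every tape of D, the overwritten symbol and the
  -- move made. States are not logged, since only the tapes have to be restored. The last Boolean of
  -- `Q` is the parity of the current question.
  Entry X Stage Role Q : Set
  Entry = Vec (Symbol Aux × Move) (suc k)
  X     = Aux ⊎ Entry
  Stage = (Bool ⊎ Bool) ⊎ (State ⊎ (Bool ⊎ (Bool ⊎ Bool)))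
  Role  = ⊤ ⊎ Bool
  Q     = Stage × (Role × Bool)

  pattern back b    = inj₁ (inj₁ b)
  pattern put b     = inj₁ (inj₂ b)
  pattern run q     = inj₂ (inj₁ q)
  pattern undo a    = inj₂ (inj₂ (inj₁ a))
  pattern restore a = inj₂ (inj₂ (inj₂ (inj₁ a)))
  pattern decide a  = inj₂ (inj₂ (inj₂ (inj₂ a)))

  -- The bit of `live b` tells apart the two transitions of a split, which `δ-unique` requires to be
  -- distinct.
  pattern spare  = inj₁ tt
  pattern live b = inj₂ b

  pattern entry e = aux (inj₂ e)

  Symbols Actions Transitions : Set
  Symbols     = Vec (Symbol X) (suc (suc k))
  Actions     = Vec (Symbol X × Move) (suc (suc k))
  Transitions = List (Q × Actions)

  decode₁ : Symbol X → Symbol Aux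
  decode₁ = dec injection₁

  -- The log is the second tape; the others belong to D.
  thread : ∀ {A : Set} → A → Vec A (suc k) → Vec A (suc (suc k))
  thread l (t ∷ ts) = t ∷ l ∷ ts

  idle : ∀ {n} → Vec (Symbol X) n → Vec (Symbol X × Move) n
  idle = Vec.map (_, stay)

  embed : Symbol Aux × Move → Symbol X × Move
  embed (s , m) = emb injection₁ s , m

  remember : Symbol Aux → Symbol Aux × Move → Symbol Aux × Move
  remember s (_ , m) = s , m

  retreat : Symbol X → Symbol Aux × Move → Symbol X × Move
  retreat s (_ , m) = s , opposite m

  reinstate : Symbol Aux × Move → Symbol X × Move
  reinstate (s , _) = emb injection₁ s , stay

  forward : Role × Bool → Bool → Vec (Symbol X) (suc k) → Symbol X → Vec (Symbol Aux) (suc k) →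
            List (State × Vec (Symbol Aux × Move) (suc k)) → Q × Actions
  forward r a s l s′ []             = (undo a , r) , thread (l , left) (idle s)
  forward r a s l s′ ((q , as) ∷ _) =
    (run q , r) , thread (entry (Vec.zipWith remember s′ as) , right) (Vec.map embed as)

  -- `act` writes before it moves, whereas reversing a step means moving back before writing. Each
  -- entry thus takes two steps, the move here and the write in `restoring`.
  undoing : Role × Bool → Bool → Vec (Symbol X) (suc k) → Symbol X → Q × Actions
  undoing r a s (entry e) = (restore a , r) , thread (entry e , stay) (Vec.zipWith retreat s e)
  undoing r a s l         = (decide a , r) , thread (l , right) (idle s)

  restoring : Role × Bool → Bool → Vec (Symbol X) (suc k) → Symbol X → Q × Actions
  restoring r a s (entry e) = (undo a , r) , thread (entry e , left) (Vec.map reinstate e)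
  -- A default: the stage `restore` is entered only with the log's head on an entry.
  restoring r a s l         = (undo a , r) , thread (l , stay) (idle s)

  -- Horner's rule: a prefix with value v has v live paths and one spare path.
  deciding : Bool → Role → Bool → List Q
  deciding false r        false = []
  deciding false r        true  = [ (back true , r , true) ]
  deciding true  spare    false = [ (back true , spare , false) ]
  deciding true  spare    true  = (back true , spare , false) ∷ (back true , live false , false) ∷ []
  deciding true  (live _) a     = (back true , live false , false) ∷ (back true , live true , false) ∷ []

  δ′ : Q → Symbols → Transitions
  δ′ (back b , r)           (s ∷ l ∷ ss) = [ ((put b , r) , (s , left) ∷ idle (l ∷ ss)) ]
  δ′ (put b , r)            (s ∷ ss)     = [ ((run (NPTM.start D) , r) , (bit b , stay) ∷ idle ss) ]
  δ′ (run q , r)            (s ∷ l ∷ ss) = [ forward r (accepting q) (s ∷ ss) l s′ (δ q s′) ]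
    where s′ = Vec.map decode₁ (s ∷ ss)
  δ′ (undo a , r)           (s ∷ l ∷ ss) = [ undoing r a (s ∷ ss) l ]
  δ′ (restore a , r)        (s ∷ l ∷ ss) = [ restoring r a (s ∷ ss) l ]
  δ′ (decide a , r , odd) s            = map (λ q → q , idle s) (deciding odd r a)

  deciding-unique : ∀ odd r a → Unique (deciding odd r a)
  deciding-unique false r        false = []
  deciding-unique false r        true  = [] ∷ []
  deciding-unique true  spare    false = [] ∷ []
  deciding-unique true  spare    true  = ((λ ()) ∷ []) ∷ [] ∷ []
  deciding-unique true  (live _) a     = ((λ ()) ∷ []) ∷ [] ∷ []

  δ′-unique : ∀ q s → Unique (δ′ q s)
  δ′-unique (back b , r)         (s ∷ l ∷ ss) = [] ∷ []
  δ′-unique (put b , r)          (s ∷ ss)     = [] ∷ []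
  δ′-unique (run q , r)          (s ∷ l ∷ ss) = [] ∷ []
  δ′-unique (undo a , r)         (s ∷ l ∷ ss) = [] ∷ []
  δ′-unique (restore a , r)      (s ∷ l ∷ ss) = [] ∷ []
  δ′-unique (decide a , r , odd) s            = Unique.map⁺ (cong proj₁) (deciding-unique odd r a)

  machine : TM
  machine = record
    { k          = suc k
    ; Aux        = X
    ; State      = Q
    ; aux-finite = ⊎-finite (NPTM.aux-finite D)
                     (Vec-finite (×-finite (Symbol-finite (NPTM.aux-finite D)) Move-finite) (suc k))
    ; st-finite  = ×-finite
        (⊎-finite (⊎-finite Bool-finite Bool-finite)
          (⊎-finite (NPTM.st-finite D) (⊎-finite Bool-finite (⊎-finite Bool-finite Bool-finite))))
        (×-finite (⊎-finite ⊤-finite Bool-finite) Bool-finite)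
    -- The first round puts the closing `false` in front of x, which asks question 0.
    ; start      = back false , spare , false
    ; accepting  = λ _ → true
    ; δ          = δ′
    ; δ-unique   = δ′-unique
    }

  RunN : ℕ → TM.Config machine → List ⊤ → Set
  RunN = Run machine (λ _ → [ tt ])

  Carry : ∀ {n} → Vec (Tape X) n → Vec (Tape Aux) n → Set
  Carry = VecPointwise.Pointwise (Decodes decode₁)

  carry-heads : ∀ {n} {ts : Vec (Tape X) n} {us} → Carry ts us → Vec.map decode₁ (Vec.map head ts) ≡ Vec.map head us
  carry-heads []        = refl
  carry-heads (d ∷ ds) = cong₂ _∷_ (decodes-head d) (carry-heads ds)

  carry-act : ∀ {n} {ts : Vec (Tape X) n} {us} as → Carry ts us →
              Carry (Vec.zipWith act (Vec.map embed as) ts) (Vec.zipWith act as us)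
  carry-act []             []       = []
  carry-act ((s , m) ∷ as) (d ∷ ds) = decodes-act m d (dec-emb injection₁ s) ∷ carry-act as ds

  -- The tapes of D halfway through undoing a step: moved back, with the new symbol still in place.
  overwrite : Symbol Aux × Move → Tape Aux → Tape Aux
  overwrite (s , _) = write s

  carry-retreat : ∀ {n} {ts : Vec (Tape X) n} as us → Carry ts (Vec.zipWith act as us) →
    Carry (Vec.zipWith act (Vec.zipWith retreat (Vec.map head ts) (Vec.zipWith remember (Vec.map head us) as)) ts)
          (Vec.zipWith overwrite as us)
  carry-retreat []             []       []       = []
  carry-retreat ((s , m) ∷ as) (u ∷ us) (d ∷ ds) = decodes-unmove m d ∷ carry-retreat as us ds

  carry-rewrite : ∀ {n} {ts : Vec (Tape X) n} as us → Carry ts (Vec.zipWith overwrite as us) →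
    Carry (Vec.zipWith act (Vec.map reinstate (Vec.zipWith remember (Vec.map head us) as)) ts) us
  carry-rewrite []             []       []       = []
  carry-rewrite ((s , m) ∷ as) (u ∷ us) (d ∷ ds) =
    decodes-unwrite d (dec-emb injection₁ (head u)) ∷ carry-rewrite as us ds

  -- Only the cells left of the head are constrained. Entries of earlier queries remain to the right
  -- and are overwritten by later ones.
  record Log (es : List Entry) (l : Tape X) : Set where
    constructor log
    field
      logged : ∀ n → cell l -[1+ n ] ≡ look (map (λ e → entry e) es) n

  open Log

  -- While undoing, the head stands on the top entry, one cell left of where `Log` expects it; the
  -- invariant of that phase is therefore `Log es (move right l)`.
  log-left : ∀ {es l} → Log es l → Log es (move right (move left l))
  log-left {l = l} g .logged n =
    trans (cell-move right (move left l) -[1+ n ])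
      (trans (cell-move left l (shift right -[1+ n ]))
        (trans (cong (cell l) (shift-opposite left -[1+ n ])) (logged g n)))

  log-top : ∀ {es l} → Log es (move right l) → head l ≡ look (map (λ e → entry e) es) 0
  log-top {l = l} g = trans (sym (cell-move right l -[1+ 0 ])) (logged g 0)

  log-pop : ∀ {e es l} → Log (e ∷ es) (move right l) → Log es l
  log-pop {l = l} g .logged n = trans (sym (cell-move right l -[1+ suc n ])) (logged g (suc n))

  log-push : ∀ {es l} e → Log es l → Log (e ∷ es) (act (entry e , right) l)
  log-push {l = l} e g .logged zero    = cell-move right (write (entry e) l) -[1+ 0 ]
  log-push {l = l} e g .logged (suc n) = trans (cell-move right (write (entry e) l) -[1+ suc n ]) (logged g n)

  data History (us₀ : Vec (Tape Aux) (suc k)) : List Entry → Vec (Tape Aux) (suc k) → Set where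
    []  : History us₀ [] us₀
    _▷_ : ∀ {es us} → History us₀ es us → ∀ as →
          History us₀ (Vec.zipWith remember (Vec.map head us) as ∷ es) (Vec.zipWith act as us)

  -- Undoing restores the tapes only up to listed blanks and leaves old entries on the log, so the
  -- rest of the run must be available for all tapes that agree in this sense.
  Continuation : ℕ → Bool → Role × Bool → Vec (Tape Aux) (suc k) → List ⊤ → Set
  Continuation T a r us vs = ∀ {t l ts} → Carry (t ∷ ts) us → Log [] l →
                             RunN T (config (decide a , r) (t ∷ l ∷ ts)) vs

  step₁′ : ∀ {t c c′ vs} → TM.successors machine c ≡ [ c′ ] → RunN t c′ vs → RunN (suc t) c vs
  step₁′ = step₁ machine (λ _ → [ tt ])

  idle-rest : ∀ {q t l} (ts : Vec (Tape X) k) →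
              [ config {Q} q (t ∷ l ∷ Vec.zipWith act (idle (Vec.map head ts)) ts) ] ≡ [ config q (t ∷ l ∷ ts) ]
  idle-rest ts = cong (λ ts → [ config _ (_ ∷ _ ∷ ts) ]) (act-idle ts)

  undo-run : ∀ {T a r us₀ es us t l ts vs} → History us₀ es us → Carry (t ∷ ts) us → Log es (move right l) →
             Continuation T a r us₀ vs → RunN (length es * 2 + suc T) (config (undo a , r) (t ∷ l ∷ ts)) vs
  undo-run {l = tape l s r} {ts} [] c g continue with refl ← log-top g =
    step₁′ (idle-rest ts) (continue c g)
  undo-run {l = tape l s r} (_▷_ {us = u ∷ us} h (a ∷ as)) c g continue with refl ← log-top g
    with d ∷ ds ← carry-rewrite (a ∷ as) (u ∷ us) (carry-retreat (a ∷ as) (u ∷ us) c) =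
    step₁′ refl (step₁′ refl (undo-run h (d ∷ ds) (log-left (log-pop g)) continue))

  RunD : ℕ → NPTM.Config D → List Bool → Set
  RunD = Run (NPTM.machine D) (λ c → [ accepting (state c) ])

  -- Every step of D trades one unit of `t` for one entry, so at most `t + length es` entries get
  -- undone, at two steps each; the 2 pays for turning round at either end of the log. The value
  -- list is tied to `[ b ]` by an equation because in the recursion it has the form `us′ ++ []`.
  forward-run : ∀ {t T b q r us₀ es us u l v vs} → RunD t (config q us) v → v ≡ [ b ] →
                History us₀ es us → Carry (u ∷ vs) us → Log es l → ∀ {ws} → Continuation T b r us₀ ws →
                RunN (t + ((t + length es) * 2 + (2 + T))) (config (run q , r) (u ∷ l ∷ vs)) ws
  forward-run {t} {T} {b} {q} {r} {es = es} {us} {u} {l} {vs = vs} (halt e) refl h c g continue =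
    run-mono machine (λ _ → [ tt ])
      (≤-trans (≤-reflexive (sym (+-suc (length es * 2) (suc T))))
        (≤-trans (+-monoˡ-≤ (2 + T) (*-monoˡ-≤ 2 (m≤n+m (length es) t))) (m≤n+m _ t)))
      (step₁′ (trans (successors-≡ machine {run q , r} {u ∷ l ∷ vs} halted) (idle-rest vs))
        (undo-run h c (log-left g) continue))
    where
    halted = cong₂ (λ s x → [ forward r b (Vec.map head (u ∷ vs)) (head l) s x ]) (carry-heads c)
               (trans (cong (δ q) (carry-heads c)) (map-≡[] e))
  forward-run {suc t} {T} {q = q} {r} {us₀} {es} {us} {u} {l} {vs = vs} (step e rs) v≡ h c g {ws} continue
    with δ q (Vec.map head us) in e′ | deterministic q (Vec.map head us)
  forward-run {suc t} {T} {q = q} {r} {us₀} {es} {us} {u} {l} {vs = vs}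
    (step refl (_∷_ {us = us′} x [])) v≡ h c g {ws} continue
    | (q′ , a ∷ as) ∷ [] | _ =
    step₁′ (successors-≡ machine {run q , r} {u ∷ l ∷ vs} stepped)
      (run-mono machine (λ _ → [ tt ]) (≤-reflexive (cong (λ n → t + (n * 2 + (2 + T))) (+-suc t (length es))))
        (forward-run x (trans (sym (++-identityʳ us′)) v≡) (h ▷ (a ∷ as)) (carry-act (a ∷ as) c)
          (log-push _ g) continue))
    where
    stepped = cong₂ (λ s x → [ forward r (accepting q) (Vec.map head (u ∷ vs)) (head l) s x ]) (carry-heads c)
                (trans (cong (δ q) (carry-heads c)) e′)
  forward-run (step e rs) v≡ h c g continue | _ ∷ _ ∷ _ | s≤s ()

  paths : Role → Word → List ⊤
  paths r        []          = [ tt ]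
  paths (live _) (c ∷ o)     = paths (live false) o ++ paths (live true) o
  paths spare    (false ∷ o) = paths spare o
  paths spare    (true ∷ o)  = paths spare o ++ paths (live false) o

  length-live : ∀ b b′ o → length (paths (live b) o) ≡ length (paths (live b′) o)
  length-live b b′ []      = refl
  length-live b b′ (c ∷ o) = refl

  -- Generalised over the accumulator of the fold: on the right are the leaves below n live paths
  -- and one spare path. Reading a digit turns n live paths into 2n + digit and keeps one spare
  -- path, as the fold does with n.
  length-paths : ∀ n o → List.foldl (λ n b → 2 * n + digit b) n o + 1 ≡
                 n * length (paths (live false) o) + length (paths spare o)
  length-paths n []      = cong (_+ 1) (sym (*-identityʳ n))
  length-paths n (c ∷ o) = trans (length-paths (2 * n + digit c) o) (distribute c)
    where
    y = length (paths (live false) o)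
    z = length (paths spare o)

    double : length (paths (live false) (c ∷ o)) ≡ y + y
    double = trans (length-++ (paths (live false) o)) (cong (y +_) (length-live true false o))

    without : ∀ n y z → (2 * n + 0) * y + z ≡ n * (y + y) + z
    without = solve-∀

    with-one : ∀ n y z → (2 * n + 1) * y + z ≡ n * (y + y) + (z + y)
    with-one = solve-∀

    distribute : ∀ c → (2 * n + digit c) * y + z ≡
                 n * length (paths (live false) (c ∷ o)) + length (paths spare (c ∷ o))
    distribute false rewrite double = without n y z
    distribute true  rewrite double | length-++ (paths spare o) {paths (live false) o} = with-one n y z

  spare-value : ∀ o → length (paths spare o) ∸ 1 ≡ binaryValue o
  spare-value o = trans (cong (_∸ 1) (sym (length-paths 0 o))) (m+n∸n≡m (binaryValue o) 1)

  -- Two steps prepend a symbol, as the move must come before the write; the rest is the time of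
  -- `forward-run` from an empty log.
  roundTime : ℕ → ℕ
  roundTime N = 2 + (eval (NPTM.bound D) N + (eval (NPTM.bound D) N * 2 + 2))

  module _ {ask : Word → Bool} (asks : ∀ w → ∃[ c ] (NPTM.paths D w ≡ [ c ] × accepting (state c) ≡ ask w)) where

    ask-run : ∀ w → RunD (eval (NPTM.bound D) (length w)) (NPTM.initial D w) [ ask w ]
    ask-run w with asks w
    ... | c , e , e′ = subst (RunD _ _)
      (trans (cong (concatMap (λ c → [ accepting (state c) ])) e) (cong [_] e′))
      (paths-run D (λ c → [ accepting (state c) ]) w)

    round : ∀ {N T} b w {r t l ts vs} → length (b ∷ w) ≤ N → Carry (t ∷ ts) (tapes (NPTM.initial D w)) → Log [] l →
            Continuation T (ask (b ∷ w)) r (tapes (NPTM.initial D (b ∷ w))) vs →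
            RunN (roundTime N + T) (config (back b , r) (t ∷ l ∷ ts)) vs
    round {N} {T} b w {ts = ts} short (d ∷ ds) g continue =
      step₁′ (idle-rest ts) (step₁′ (idle-rest ts)
        (run-mono machine (λ _ → [ tt ]) bound
          (forward-run (ask-run (b ∷ w)) refl [] (decodes-prepend injection₁ b d ∷ ds) g continue)))
      where
      e = eval (NPTM.bound D) N

      reassociate : ∀ e T → e + ((e + 0) * 2 + (2 + T)) ≡ e + (e * 2 + 2) + T
      reassociate = solve-∀

      bound : eval (NPTM.bound D) (length (b ∷ w)) + ((eval (NPTM.bound D) (length (b ∷ w)) + 0) * 2 + (2 + T)) ≤
              e + (e * 2 + 2) + T
      bound = ≤-trans (+-mono-≤ mono (+-monoˡ-≤ (2 + T) (*-monoˡ-≤ 2 (+-monoˡ-≤ 0 mono)))) (≤-reflexive (reassociate e T))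
        where mono = eval-mono (NPTM.bound D) short

    module _ (x : Word) where

      idle-both : ∀ {q q′ t l} (ts : Vec (Tape X) k) →
        config {Q} q (t ∷ l ∷ Vec.zipWith act (idle (Vec.map head ts)) ts) List.∷
          config {Q} q′ (t ∷ l ∷ Vec.zipWith act (idle (Vec.map head ts)) ts) List.∷ [] ≡
        config q (t ∷ l ∷ ts) ∷ config q′ (t ∷ l ∷ ts) ∷ []
      idle-both ts = cong (λ ts → config _ (_ ∷ _ ∷ ts) List.∷ config _ (_ ∷ _ ∷ ts) List.∷ []) (act-idle ts)

      -- Induction on the bits still to be asked for. A bit takes two questions: two steps out of
      -- `decide`, two rounds, and two more symbols on the query word, whence `length o * 2`.
      decide-run : ∀ {N} o r i {t l ts} → (∀ m → ask (encode x (m + i)) ≡ answer false m o) →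
                   length (encode x i) + length o * 2 ≤ N →
                   Carry (t ∷ ts) (tapes (NPTM.initial D (encode x i))) → Log [] l →
                   RunN (length o * suc (roundTime N + suc (roundTime N)))
                     (config (decide (ask (encode x i)) , r , false) (t ∷ l ∷ ts)) (paths r o)
      -- The question for a further bit is answered no, and there `deciding` offers no transition:
      -- the path ends and counts once.
      decide-run [] r i answers short c g rewrite answers 0 = halt refl
      decide-run {N} (b ∷ o) r i {ts = ts} answers short c g rewrite answers 0 =
        step₁′ (idle-rest ts)
          (run-mono machine (λ _ → [ tt ])
            (≤-reflexive (sym (+-assoc (roundTime N) (suc (roundTime N))
              (length o * suc (roundTime N + suc (roundTime N))))))
            (round {N} true (encode x i) (≤-trans (n≤1+n _) short-word) c g
              (λ c′ g′ → bit-run r b (answers 1) c′ g′)))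
        where
        short′ : suc (suc (length (encode x i))) + length o * 2 ≤ N
        short′ = ≤-trans (≤-reflexive (sym (trans (+-suc (length (encode x i)) (suc (length o * 2)))
                                                  (cong suc (+-suc (length (encode x i)) (length o * 2)))))) short

        short-word : suc (suc (length (encode x i))) ≤ N
        short-word = ≤-trans (m≤m+n _ (length o * 2)) short′

        next : ∀ r {t l ts} → Carry (t ∷ ts) (tapes (NPTM.initial D (encode x (suc i)))) → Log [] l →
               RunN (roundTime N + length o * suc (roundTime N + suc (roundTime N)))
                 (config (back true , r , false) (t ∷ l ∷ ts)) (paths r o)
        next r c g = round {N} true (encode x (suc i)) short-word c g
          (decide-run {N} o r (suc (suc i)) answers′ short′)
          where
          answers′ : ∀ m → ask (encode x (m + suc (suc i))) ≡ answer false m o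
          answers′ m rewrite +-suc m (suc i) | +-suc m i = answers (suc (suc m))

        bit-run : ∀ r b {a t l ts} → a ≡ b →
                  Carry (t ∷ ts) (tapes (NPTM.initial D (encode x (suc i)))) → Log [] l →
                  RunN (suc (roundTime N + length o * suc (roundTime N + suc (roundTime N))))
                    (config (decide a , r , true) (t ∷ l ∷ ts)) (paths r (b ∷ o))
        bit-run spare    false {ts = ts} refl c g = step₁′ (idle-rest ts) (next spare c g)
        bit-run spare    true  {ts = ts} refl c g =
          step₂ machine (λ _ → [ tt ]) (idle-both ts) (next spare c g) (next (live false) c g)
        bit-run (live _) b     {ts = ts} refl c g =
          step₂ machine (λ _ → [ tt ]) (idle-both ts) (next (live false) c g) (next (live true) c g)

      blank-tapes : ∀ n → Carry (Vec.replicate n blankTape) (Vec.replicate n blankTape)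
      blank-tapes zero    = []
      blank-tapes (suc n) = decodes-inputTape injection₁ [] ∷ blank-tapes n

      horner-run : ∀ {N} o → (∀ m → ask (encode x m) ≡ answer false m o) → suc (length x) + length o * 2 ≤ N →
                   RunN (roundTime N + length o * suc (roundTime N + suc (roundTime N)))
                     (TM.initial machine x) (paths spare o)
      horner-run {N} o answers short =
        round {N} false x (≤-trans (m≤m+n _ _) short) (decodes-inputTape injection₁ x ∷ blank-tapes k) (log λ n → refl)
          (decide-run {N} o spare 0 (λ m → trans (cong (ask ∘ encode x) (+-identityʳ m)) (answers m)) short)

-- Length of the output

length-after-act : ∀ {X} a (t : Tape X) → length (after (act a t)) ≤ suc (length (after t))
length-after-act (s , left)  (tape []      _ r)       = ≤-refl
length-after-act (s , left)  (tape (_ ∷ _) _ r)       = ≤-refl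
length-after-act (s , stay)  (tape _       _ r)       = n≤1+n _
length-after-act (s , right) (tape _       _ [])      = z≤n
length-after-act (s , right) (tape _       _ (_ ∷ r)) = ≤-trans (n≤1+n _) (n≤1+n _)

length-leadingBits : ∀ {X} (ss : List (Symbol X)) → length (leadingBits ss) ≤ length ss
length-leadingBits []           = z≤n
length-leadingBits (blank ∷ ss) = z≤n
length-leadingBits (bit b ∷ ss) = s≤s (length-leadingBits ss)
length-leadingBits (aux _ ∷ ss) = z≤n

module _ (M : TM) where
  open TM M

  AfterWithin : ℕ → Config → Set
  AfterWithin m c = length (after (Vec.head (tapes c))) ≤ m

  successors-within : ∀ {m} c → AfterWithin m c → All (AfterWithin (suc m)) (successors c)
  successors-within {m} (config q (t ∷ ts)) c≤m = All.map⁺ (All.universal within _)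
    where
    within : ∀ ((q′ , as) : State × Vec (Symbol Aux × Move) (suc k)) →
             AfterWithin (suc m) (config q′ (Vec.zipWith act as (t ∷ ts)))
    within (q′ , a ∷ as) = ≤-trans (length-after-act a t) (s≤s c≤m)

  leaves-within : ∀ t {m} c → AfterWithin m c → All (AfterWithin (t + m)) (leaves t c)
  leaves-within zero    c c≤m = c≤m ∷ []
  leaves-within (suc t) {m} c c≤m with successors c | successors-within c c≤m
  ... | []      | _  = ≤-trans c≤m (m≤n+m m (suc t)) ∷ []
  ... | c′ ∷ cs | ps = All.concat⁺ (All.map⁺ (All.map below ps))
    where
    below : ∀ {c} → AfterWithin (suc m) c → All (AfterWithin (suc t + m)) (leaves t c)
    below {c} c≤ = All.map (λ p → ≤-trans p (≤-reflexive (+-suc t m))) (leaves-within t c c≤)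

-- The language of output bits and the machine with f x + 1 paths

module _ {f : Word → ℕ} (M : NPTM)
  (spec : ∀ x → ∃[ c ] (NPTM.acceptingPaths M x ≡ [ c ] × NPTM.output M c ≡ f x)) where

  -- The word actually written, leading zeros included, rather than a normal form of f x: on leading
  -- zeros the spare path simply goes on without splitting.
  out : Word → Word
  out x = tapeBits (Vec.head (tapes (proj₁ (spec x))))

  out-spec : ∀ x → ∃[ c ] (NPTM.acceptingPaths M x ≡ [ c ] × tapeBits (Vec.head (tapes c)) ≡ out x)
  out-spec x = proj₁ (spec x) , proj₁ (proj₂ (spec x)) , refl

  -- The cell under the head, at most n cells to its right at the start, and at most one more for
  -- each step.
  outLength : ℕ → ℕ
  outLength n = suc (eval (NPTM.bound M) n + n)

  length-out : ∀ x → length (out x) ≤ outLength (length x)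
  length-out x = ≤-trans (length-leadingBits (head t ∷ after t)) (s≤s within)
    where
    t = Vec.head (tapes (proj₁ (spec x)))

    initially : ∀ x → length (after (inputTape {NPTM.Aux M} x)) ≤ length x
    initially []      = z≤n
    initially (b ∷ x) = ≤-trans (≤-reflexive (length-map bit x)) (n≤1+n _)

    within : length (after t) ≤ eval (NPTM.bound M) (length x) + length x
    within = All.head (subst (All _) (proj₁ (proj₂ (spec x)))
      (All.filter⁺ (λ c → T? (NPTM.accepting M (state c)))
        (leaves-within (NPTM.machine M) (eval (NPTM.bound M) (length x)) (NPTM.initial M x) (initially x))))

  Bits : Language
  Bits w = query out 0 w ≡ true

  Bits-UP : UP Bits
  Bits-UP = decider out-spec , λ w → in-L w , out-L w
    where
    open Query M true
    in-L : ∀ w → Bits w → NPTM.acc (decider out-spec) w ≡ 1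
    in-L w w∈L rewrite acc-decider out-spec w | w∈L = refl
    out-L : ∀ w → ¬ Bits w → NPTM.acc (decider out-spec) w ≡ 0
    out-L w w∉L rewrite acc-decider out-spec w | ¬-not w∉L = refl

  Bits-coUP : coUP Bits
  Bits-coUP = decider out-spec , λ w → out-L w , in-L w
    where
    open Query M false
    out-L : ∀ w → ¬ Bits w → NPTM.acc (decider out-spec) w ≡ 1
    out-L w w∉L rewrite acc-decider out-spec w | ¬-not w∉L = refl
    in-L : ∀ w → ¬ ¬ Bits w → NPTM.acc (decider out-spec) w ≡ 0
    in-L w ¬w∉L rewrite acc-decider out-spec w | decidable-stable (query out 0 w Bool.≟ true) ¬w∉L = refl

  Bits-P⇒TotP : P Bits → TotP f
  Bits-P⇒TotP (D , deterministic , decides) = N , f≡tot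
    where
    open Querying D deterministic using (machine; paths; spare-value; roundTime; horner-run)

    asks : ∀ w → ∃[ c ] (NPTM.paths D w ≡ [ c ] × NPTM.accepting D (state c) ≡ query out 0 w)
    asks w with deterministic-path D deterministic w | decides w
    ... | c , e | in-L , out-L = c , e , agree
      where
      agree : NPTM.accepting D (state c) ≡ query out 0 w
      agree with query out 0 w in q | NPTM.accepting D (state c) in a
      ... | true  | true  = refl
      ... | false | false = refl
      ... | true  | false = ⊥-elim (n≮n 0 (subst (0 <_) none (in-L refl)))
        where
        none : NPTM.acc D w ≡ 0
        none rewrite e | a = refl
      ... | false | true  = ⊥-elim (1+n≢0 (trans (sym one) (out-L λ ())))
        where
        one : NPTM.acc D w ≡ 1
        one rewrite e | a = refl

    -- Bounds the last query word `encode x i`, where i is twice the number of bits and `encode x 0`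
    -- has length `suc n`.
    queryLength : ℕ → ℕ
    queryLength n = suc n + outLength n * 2

    time : ℕ → ℕ
    time n = roundTime (queryLength n) +
             outLength n * suc (roundTime (queryLength n) + suc (roundTime (queryLength n)))

    run : ∀ x → Run machine (λ _ → [ tt ]) (time (length x)) (TM.initial machine x) (paths (inj₁ tt) (out x))
    run x = run-mono machine (λ _ → [ tt ])
      (+-monoʳ-≤ (roundTime (queryLength (length x))) (*-monoˡ-≤ _ (length-out x)))
      (horner-run asks x (out x)
        (λ m → trans (query-encode out x m 0) (cong (λ j → answer false j (out x)) (+-identityʳ m)))
        (+-monoʳ-≤ (suc (length x)) (*-monoˡ-≤ 2 (length-out x))))

    time-poly : IsPolynomial time
    time-poly = +-isPolynomial round (*-isPolynomial out-poly (suc-poly (+-isPolynomial round (suc-poly round))))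
      where
      suc-poly : ∀ {g} → IsPolynomial g → IsPolynomial (λ n → suc (g n))
      suc-poly = +-isPolynomial (const-isPolynomial 1)

      out-poly : IsPolynomial outLength
      out-poly = suc-poly (+-isPolynomial (eval-isPolynomial (NPTM.bound M)) id-isPolynomial)

      query-poly : IsPolynomial queryLength
      query-poly = +-isPolynomial (suc-poly id-isPolynomial) (*-isPolynomial out-poly (const-isPolynomial 2))

      D-poly : IsPolynomial (λ n → eval (NPTM.bound D) (queryLength n))
      D-poly = ∘-isPolynomial (NPTM.bound D) query-poly

      round : IsPolynomial (λ n → roundTime (queryLength n))
      round = +-isPolynomial (const-isPolynomial 2)
        (+-isPolynomial D-poly (+-isPolynomial (*-isPolynomial D-poly (const-isPolynomial 2)) (const-isPolynomial 2)))

    N : NPTM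
    N = clocked machine (λ _ → [ tt ]) time-poly run

    f≡tot : f ≗ NPTM.tot N
    f≡tot x = begin
      f x                  ≡⟨ sym (proj₂ (proj₂ (spec x))) ⟩
      binaryValue (out x)  ≡⟨ sym (spare-value (out x)) ⟩
      length (paths (inj₁ tt) (out x)) ∸ 1
        ≡⟨ cong (λ vs → length vs ∸ 1) (sym (clocked-values machine (λ _ → [ tt ]) time-poly run x)) ⟩
      length (concatMap (λ _ → [ tt ]) (NPTM.paths N x)) ∸ 1
        ≡⟨ cong (_∸ 1) (length-concatMap-[tt] (NPTM.paths N x)) ⟩
      NPTM.tot N x ∎
      where open ≡-Reasoning

proposition4p1 : (UPSVₜ ⊆ TotP) ⇔ (P ≐ (UP ∩ coUP))
proposition4p1 = mk⇔
  (λ UPSVₜ⊆TotP → (λ {L} → P⊆UP∩coUP {L}) , λ {L} → UPSVₜ⊆TotP⇒UP∩coUP⊆P (λ {f} → UPSVₜ⊆TotP {f}) {L})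
  (λ { (_ , UP∩coUP⊆P) {f} (M , spec) →
       Bits-P⇒TotP {f} M spec (UP∩coUP⊆P (Bits-UP {f} M spec , Bits-coUP {f} M spec)) })
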